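{- For every integer $s\ge 1$ there exists an integer $k\ge 2$ such that, for every claw-free matroid $M=(E,G)$ with $\alpha(M)\le s$, there is a flat $F$ of $G$ of codimension at most $k$ such that $M|F$ is isomorphic to an iterated lift-join $(\cdots((M_1\otimes M_2)\otimes M_3)\cdots)\otimes M_{2s+1}$ of $2s+1$ matroids $M_1,\dots,M_{2s+1}$ whose complements are triangle-free.
   Context: A matroid is a pair $M=(E,G)$ where $G$ is the set of nonzero vectors of a finite-dimensional $\mathbb F_2$-vector space $V(G)=G\cup\{0\}\cong\mathbb F_2^n$ and $E\subseteq G$; $n\ge0$ is its dimension (dimension $0$ allowed). Isomorphism: a linear isomorphism of ambient spaces mapping ground sets onto each other. A flat of $G$ is a set $F\subseteq G$ with $F\cup\{0\}$ a subspace; its dimension is that of the subspace, its codimension is $\dim(G)-\dim(F)$. Triangles are $2$-dimensional flats. $M|F=(E\cap F,F)$. A claw is $(B,G)$ with $\dim G=3$, $B$ a basis; $M$ is claw-free if no $M|F$ is isomorphic to a claw. The complement is $M^c=(G\setminus E,G)$; $M$ is triangle-free if $E$ contains no triangle. $\omega(M)$ is the largest dimension of a flat contained in $E$, and $\alpha(M)=\omega(M^c)$. Lift-join: $M_1\otimes M_2=(E_1\cup(E_2+V(G_1)),G_1\oplus G_2)$ for $M_i=(E_i,G_i)$, where $G_1\oplus G_2$ is the set of nonzero vectors of $V(G_1)\oplus V(G_2)$ with each $V(G_i)$ identified with its copy, and $X+Y=\{x+y:x\in X,y\in Y\}$. -}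

module Defs where

open import Data.Nat using (ℕ; zero; suc; _+_; _≤_)
open import Data.Bool using (Bool; true; false; not; _∧_; _xor_; if_then_else_)
open import Data.Vec using (Vec; []; _∷_; replicate; zipWith)
open import Data.Product using (Σ; _,_; proj₁; proj₂; ∃; _×_)
open import Data.Sum using (_⊎_)
open import Relation.Binary.PropositionalEquality using (_≡_; _≢_; refl; cong)
open import Relation.Nullary using (¬_)
open import Function.Bundles using (_⇔_)

-- The ambient space F₂ⁿ, represented as Vec Bool n.
-- G (the nonzero vectors) is implicit: V n ∖ {𝟎}.

V : ℕ → Set
V n = Vec Bool n

𝟎 : ∀ {n} → V n
𝟎 {n} = replicate n false

infixl 6 _⊕_
_⊕_ : ∀ {n} → V n → V n → V n
_⊕_ = zipWith _xor_

_·_ : ∀ {n} → Bool → V n → V n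
true  · v = v
false · v = 𝟎

isZero : ∀ {n} → V n → Bool
isZero []      = true
isZero (b ∷ v) = not b ∧ isZero v

isZero-𝟎 : ∀ n → isZero (𝟎 {n}) ≡ true
isZero-𝟎 zero    = refl
isZero-𝟎 (suc n) = isZero-𝟎 n

-- F₂-linearity (additivity suffices over F₂)
Linear : ∀ {m n} → (V m → V n) → Set
Linear f = ∀ x y → f (x ⊕ y) ≡ f x ⊕ f y

-- A matroid M = (E, G) of dimension n: E ⊆ G = nonzero vectors of F₂ⁿ,
-- given by its (Boolean) indicator, which is false at 𝟎.

record Matroid (n : ℕ) : Set where
  field
    E     : V n → Bool
    E-𝟎   : E 𝟎 ≡ false
open Matroid public

record Iso {m n : ℕ} (M : Matroid m) (N : Matroid n) : Set where
  field
    to       : V m → V n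
    from     : V n → V m
    to-lin   : Linear to
    from-to  : ∀ x → from (to x) ≡ x
    to-from  : ∀ y → to (from y) ≡ y
    preserves : ∀ x → E N (to x) ≡ E M x

-- Flats.  A flat F of dimension d of G (with G of dimension n) is given
-- by an injective linear map ψ : F₂ᵈ → F₂ⁿ whose image is F ∪ {0}
-- (i.e. a choice of linear coordinates on F ∪ {0}).

record Flat (d n : ℕ) : Set where
  field
    emb     : V d → V n
    emb-lin : Linear emb
    emb-inj : ∀ x y → emb x ≡ emb y → x ≡ y
open Flat public

emb-𝟎 : ∀ {d n} (ψ : Flat d n) → emb ψ 𝟎 ≡ 𝟎
emb-𝟎 {d} {n} ψ = lemma (emb ψ 𝟎) (cancel)
  where
    xx : ∀ {k} (v : V k) → v ⊕ v ≡ 𝟎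
    xx []          = refl
    xx (false ∷ v) = cong (false ∷_) (xx v)
    xx (true ∷ v)  = cong (false ∷_) (xx v)
    cancel : emb ψ 𝟎 ≡ emb ψ 𝟎 ⊕ emb ψ 𝟎
    cancel = Relation.Binary.PropositionalEquality.trans
               (cong (emb ψ) (Relation.Binary.PropositionalEquality.sym (xx 𝟎)))
               (emb-lin ψ 𝟎 𝟎)
    lemma : ∀ {k} (v : V k) → v ≡ v ⊕ v → v ≡ 𝟎
    lemma v p = Relation.Binary.PropositionalEquality.trans p (xx v)

-- The restriction M|F, expressed in the coordinates of F given by ψ
-- (it is isomorphic to (E ∩ F, F) via ψ).
restrict : ∀ {n d} → Matroid n → Flat d n → Matroid d
restrict M ψ = record
  { E   = λ x → E M (emb ψ x)
  ; E-𝟎 = Relation.Binary.PropositionalEquality.trans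
            (cong (E M) (emb-𝟎 ψ)) (E-𝟎 M) }

FlatIn : ∀ {n d} → Matroid n → Flat d n → Set
FlatIn M ψ = ∀ x → x ≢ 𝟎 → E M (emb ψ x) ≡ true

-- b₁ b₂ b₃ is a basis of F₂³ (linearly independent; three vectors in a
-- 3-dimensional space).
Basis3 : V 3 → V 3 → V 3 → Set
Basis3 b₁ b₂ b₃ = ∀ c₁ c₂ c₃ → (c₁ · b₁) ⊕ (c₂ · b₂) ⊕ (c₃ · b₃) ≡ 𝟎 →
                  (c₁ ≡ false) × (c₂ ≡ false) × (c₃ ≡ false)

IsClaw : Matroid 3 → Set
IsClaw C = Σ (V 3) λ b₁ → Σ (V 3) λ b₂ → Σ (V 3) λ b₃ →
  Basis3 b₁ b₂ b₃ × (∀ x → (E C x ≡ true) ⇔ (x ≡ b₁ ⊎ x ≡ b₂ ⊎ x ≡ b₃))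

ClawFree : ∀ {n} → Matroid n → Set
ClawFree {n} M = ∀ (ψ : Flat 3 n) (C : Matroid 3) → IsClaw C → ¬ Iso (restrict M ψ) C

complement : ∀ {n} → Matroid n → Matroid n
complement {n} M = record
  { E   = λ x → if isZero x then false else not (E M x)
  ; E-𝟎 = helper (isZero (𝟎 {n})) (isZero-𝟎 n) }
  where
    helper : ∀ b → b ≡ true → (if b then false else not (E M 𝟎)) ≡ false
    helper true _ = refl

ω≤ : ∀ {n} → Matroid n → ℕ → Set
ω≤ {n} M s = ∀ d (ψ : Flat d n) → FlatIn M ψ → d ≤ s

α≤ : ∀ {n} → Matroid n → ℕ → Set
α≤ M s = ω≤ (complement M) s

TriangleFree : ∀ {n} → Matroid n → Set
TriangleFree {n} M = ∀ (ψ : Flat 2 n) → ¬ FlatIn M ψ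

-- Lift-join.  V(G₁) ⊕ V(G₂) = F₂^(a+b), with V(G₁) the first a
-- coordinates and V(G₂) the last b coordinates.

fstV : ∀ a {b} → V (a + b) → V a
fstV zero    v       = []
fstV (suc a) (x ∷ v) = x ∷ fstV a v

sndV : ∀ a {b} → V (a + b) → V b
sndV zero    v       = v
sndV (suc a) (x ∷ v) = sndV a v

fstV-𝟎 : ∀ a {b} → fstV a (𝟎 {a + b}) ≡ 𝟎
fstV-𝟎 zero    = refl
fstV-𝟎 (suc a) = cong (false ∷_) (fstV-𝟎 a)

sndV-𝟎 : ∀ a {b} → sndV a (𝟎 {a + b}) ≡ 𝟎 {b}
sndV-𝟎 zero    = refl
sndV-𝟎 (suc a) = sndV-𝟎 a

-- E₁ ∪ (E₂ + V(G₁)) : a vector (x, y) lies in it iff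
-- (y = 0 and x ∈ E₁) or y ∈ E₂.
_⊗_ : ∀ {a b} → Matroid a → Matroid b → Matroid (a + b)
_⊗_ {a} {b} M₁ M₂ = record
  { E   = λ v → if isZero (sndV a v) then E M₁ (fstV a v) else E M₂ (sndV a v)
  ; E-𝟎 = helper }
  where
    open Relation.Binary.PropositionalEquality using (trans; sym)
    helper : (if isZero (sndV a {b} (𝟎 {a + b})) then E M₁ (fstV a {b} 𝟎) else E M₂ (sndV a {b} 𝟎)) ≡ false
    helper rewrite sndV-𝟎 a {b} | isZero-𝟎 b | fstV-𝟎 a {b} = E-𝟎 M₁

AnyMatroid : Set
AnyMatroid = Σ ℕ Matroid

_⊗'_ : AnyMatroid → AnyMatroid → AnyMatroid
(a , M₁) ⊗' (b , M₂) = (a + b , M₁ ⊗ M₂)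

iterLiftJoin : ∀ {m} → Vec AnyMatroid (suc m) → AnyMatroid
iterLiftJoin (M ∷ Ms) = go M Ms
  where
    go : ∀ {k} → AnyMatroid → Vec AnyMatroid k → AnyMatroid
    go acc []       = acc
    go acc (N ∷ Ns) = go (acc ⊗' N) Ns

{-# OPTIONS --safe #-}
module Submission where

-- Let N be the complement of E and X = N ∪ {0}.  Claw-freeness says that E
-- meets every coset of a subspace W ⊆ X in an affine subspace (or not at all).
-- Take W ⊆ X of the maximal dimension s and write V = W ⊕ H.  For y ∈ H let
-- L(y) ≤ W* be the space of functionals constant on E ∩ (y + W); E is recovered
-- from L and the values of these functionals.  For x + y + z = 0 in H, a
-- functional λ ∈ L(x) either lies in L(y) ∩ L(z), where the values add up, or
-- L(y) + ⟨λ⟩ = L(z) + ⟨λ⟩.  Let k be the largest size for which the y with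
-- |L(y)| ≥ k span H, and T ≠ H the span of those with |L(y)| > k.  Then L is
-- constant on each coset c + T ≠ T and L(c) ⊆ L(t) for t ∈ T.
--  * If all c ∉ T with |L(c)| = k share the same proper L₀ ⊂ W*, the t + w with
--    t ∈ T on which L₀ takes its values on t + W form a nontrivial decomposer.
--  * Otherwise, either L₀ = W* or two different spaces of size k occur outside T
--    (the "PG-sum" and "even-plane" situations).  Sums of vectors with different
--    L are then governed by L alone, so the stabiliser of L has index bounded in
--    s, and on a flat of bounded codimension some λ ≠ 0 lies in every L(y), up to
--    a lift-join with a projective geometry.  Then E lies in a hyperplane not
--    containing W, and restricting to it lowers α.

open import Defs
open import Data.Bool using (Bool; true; false; not; _∧_; _xor_; if_then_else_)
open import Data.Bool.Properties as Bool
  using (xor-assoc; xor-comm; xor-same; xor-identityʳ; ∧-distribˡ-xor; ∧-comm; ¬-not)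
open import Data.Empty using (⊥-elim)
open import Data.Fin using (Fin; zero; suc; join; splitAt)
open import Data.Fin.Properties using (injective⇒≤; splitAt-join; join-splitAt)
open import Data.Nat using (ℕ; zero; suc; _+_; _*_; _∸_; _≤_; _<_; z≤n; s≤s; _≤?_; _≤′_; ≤′-refl; ≤′-step)
open import Data.Nat.Induction using (<-rec)
import Data.Nat.Properties as ℕ
open import Data.Nat.Solver using (module +-*-Solver)
open import Data.Product using (Σ; ∃; ∃₂; _,_; proj₁; proj₂; _×_)
open import Data.Sum using (_⊎_; inj₁; inj₂; [_,_]′)
open import Data.Vec using (Vec; []; _∷_; _++_; lookup; map; replicate)
open import Data.Vec.Membership.Propositional using (_∈_)
open import Data.Vec.Membership.Propositional.Properties using (∈-map⁺; ∈-++⁺ˡ; ∈-++⁺ʳ)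
import Data.Vec.Properties as Vec
open import Data.Vec.Relation.Unary.Any using (here; there)
open import Function using (_∘_; id)
open import Function.Bundles using (mk⇔)
open import Relation.Binary.PropositionalEquality
  using (_≡_; _≢_; refl; sym; trans; cong; cong₂; subst; subst₂; module ≡-Reasoning)
open import Relation.Nullary using (¬_; Dec; yes; no; does; contradiction)
open import Relation.Nullary.Decidable
  using (_×-dec_; _→-dec_; _⊎-dec_; ¬?; map′; decidable-stable; dec-true; dec-false)

-- Maximality of W enters twice. It makes every fibre over a nonzero `y` nonempty, and it makes the
-- values of the functionals add up: if they did not, a hyperplane of W together with two vectors
-- outside W would span a larger clique. Claw-freeness alone gives only the affine fibres and the
-- exchange rule between the spaces L.
--
-- The obstacle in bounding the index of the stabiliser is that nothing controls the sum of two
-- vectors with equal spaces. Such vectors are compared through a third one with a different space,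
-- which is why that argument needs two different spaces to occur. The number of possible spaces
-- then gives the doubly exponential summand of `bound`.
--
-- All statements concern subspaces of one fixed ambient space, so that recursive calls need no
-- change of coordinates; lift-joins of matroids appear only when a finished chain of subspaces is
-- translated.

private variable
  k l m n s t : ℕ

-- Vector algebra over F₂

⊕-assoc : (x y z : V n) → (x ⊕ y) ⊕ z ≡ x ⊕ (y ⊕ z)
⊕-assoc = Vec.zipWith-assoc xor-assoc

⊕-comm : (x y : V n) → x ⊕ y ≡ y ⊕ x
⊕-comm = Vec.zipWith-comm xor-comm

⊕-identityˡ : (x : V n) → 𝟎 ⊕ x ≡ x
⊕-identityˡ = Vec.zipWith-identityˡ (λ _ → refl)

⊕-identityʳ : (x : V n) → x ⊕ 𝟎 ≡ x
⊕-identityʳ = Vec.zipWith-identityʳ xor-identityʳ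

⊕-self : (x : V n) → x ⊕ x ≡ 𝟎
⊕-self []      = refl
⊕-self (b ∷ x) = cong₂ _∷_ (xor-same b) (⊕-self x)

⊕-interchange : (a b c d : V n) → (a ⊕ b) ⊕ (c ⊕ d) ≡ (a ⊕ c) ⊕ (b ⊕ d)
⊕-interchange a b c d = begin
  (a ⊕ b) ⊕ (c ⊕ d) ≡⟨ ⊕-assoc a b (c ⊕ d) ⟩
  a ⊕ (b ⊕ (c ⊕ d)) ≡⟨ cong (a ⊕_) (sym (⊕-assoc b c d)) ⟩
  a ⊕ ((b ⊕ c) ⊕ d) ≡⟨ cong (λ t → a ⊕ (t ⊕ d)) (⊕-comm b c) ⟩
  a ⊕ ((c ⊕ b) ⊕ d) ≡⟨ cong (a ⊕_) (⊕-assoc c b d) ⟩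
  a ⊕ (c ⊕ (b ⊕ d)) ≡⟨ sym (⊕-assoc a c (b ⊕ d)) ⟩
  (a ⊕ c) ⊕ (b ⊕ d) ∎
  where open ≡-Reasoning

·-xor : (a b : Bool) (x : V n) → (a xor b) · x ≡ a · x ⊕ b · x
·-xor false b     x = sym (⊕-identityˡ _)
·-xor true  false x = sym (⊕-identityʳ x)
·-xor true  true  x = sym (⊕-self x)

comb : Vec (V n) k → V k → V n
comb []       []      = 𝟎
comb (g ∷ gs) (b ∷ u) = b · g ⊕ comb gs u

comb-⊕ : (g : Vec (V n) k) (u v : V k) → comb g (u ⊕ v) ≡ comb g u ⊕ comb g v
comb-⊕ []       []      []      = sym (⊕-identityˡ _)
comb-⊕ (g ∷ gs) (a ∷ u) (b ∷ v) =
  trans (cong₂ _⊕_ (·-xor a b g) (comb-⊕ gs u v)) (⊕-interchange _ _ _ _)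

comb-𝟎 : (g : Vec (V n) k) → comb g 𝟎 ≡ 𝟎
comb-𝟎 []       = refl
comb-𝟎 (g ∷ gs) = trans (⊕-identityˡ _) (comb-𝟎 gs)

comb-∈ : {g : Vec (V n) k} {x : V n} → x ∈ g → ∃ λ u → comb g u ≡ x
comb-∈ {g = g ∷ gs} (here refl) = true ∷ 𝟎 , trans (cong (g ⊕_) (comb-𝟎 gs)) (⊕-identityʳ g)
comb-∈ (there x∈) with u , eq ← comb-∈ x∈ = false ∷ u , trans (⊕-identityˡ _) eq

comb-++ : (g : Vec (V n) k) (h : Vec (V n) l) (v : V (k + l)) →
          comb (g ++ h) v ≡ comb g (fstV k v) ⊕ comb h (sndV k v)
comb-++ []       h v       = sym (⊕-identityˡ _)
comb-++ (g ∷ gs) h (b ∷ v) = trans (cong (b · g ⊕_) (comb-++ gs h v)) (sym (⊕-assoc _ _ _))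

fstV-++ : (x : V k) (y : V l) → fstV k (x ++ y) ≡ x
fstV-++ []      y = refl
fstV-++ (b ∷ x) y = cong (b ∷_) (fstV-++ x y)

sndV-++ : (x : V k) (y : V l) → sndV k (x ++ y) ≡ y
sndV-++ []      y = refl
sndV-++ (b ∷ x) y = sndV-++ x y

++-fstV-sndV : ∀ k {l} (v : V (k + l)) → fstV k v ++ sndV k v ≡ v
++-fstV-sndV zero    v       = refl
++-fstV-sndV (suc k) (b ∷ v) = cong (b ∷_) (++-fstV-sndV k v)

++-𝟎 : ∀ k {l} → 𝟎 {k} ++ 𝟎 {l} ≡ 𝟎
++-𝟎 zero    = refl
++-𝟎 (suc k) = cong (false ∷_) (++-𝟎 k)

fstV-sndV-𝟎 : ∀ k {l} (v : V (k + l)) → fstV k v ≡ 𝟎 → sndV k v ≡ 𝟎 → v ≡ 𝟎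
fstV-sndV-𝟎 k v p q = trans (sym (++-fstV-sndV k v)) (trans (cong₂ _++_ p q) (++-𝟎 k))

comb-++′ : (g : Vec (V n) k) (h : Vec (V n) l) (x : V k) (y : V l) →
           comb (g ++ h) (x ++ y) ≡ comb g x ⊕ comb h y
comb-++′ g h x y = trans (comb-++ g h (x ++ y))
  (cong₂ (λ a b → comb g a ⊕ comb h b) (fstV-++ x y) (sndV-++ x y))

comb-map : (f : V m → V n) → Linear f → f 𝟎 ≡ 𝟎 →
           (g : Vec (V m) k) (u : V k) → comb (map f g) u ≡ f (comb g u)
comb-map f lin f𝟎 []       []          = sym f𝟎
comb-map f lin f𝟎 (g ∷ gs) (true ∷ u)  =
  trans (cong (f g ⊕_) (comb-map f lin f𝟎 gs u)) (sym (lin g _))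
comb-map f lin f𝟎 (g ∷ gs) (false ∷ u) =
  trans (⊕-identityˡ _) (trans (comb-map f lin f𝟎 gs u) (cong f (sym (⊕-identityˡ _))))

-- A reflective solver for identities in an F₂-vector space: an expression in
-- k variables normalises to its coefficient vector.

infixl 6 _:⊕_
data Expr : ℕ → Set where
  v₀   : Expr (suc k)
  ↑_   : Expr k → Expr (suc k)
  :𝟎   : Expr k
  _:⊕_ : Expr k → Expr k → Expr k

pattern v₁ = ↑ v₀
pattern v₂ = ↑ v₁
pattern v₃ = ↑ v₂

⟦_⟧ : Expr k → Vec (V n) k → V n
⟦ v₀ ⟧     (x ∷ ρ) = x
⟦ ↑ a ⟧    (x ∷ ρ) = ⟦ a ⟧ ρ
⟦ :𝟎 ⟧     ρ       = 𝟎
⟦ a :⊕ b ⟧ ρ       = ⟦ a ⟧ ρ ⊕ ⟦ b ⟧ ρ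

normalise : Expr k → V k
normalise v₀       = true ∷ 𝟎
normalise (↑ a)    = false ∷ normalise a
normalise :𝟎       = 𝟎
normalise (a :⊕ b) = normalise a ⊕ normalise b

normalise-correct : (e : Expr k) (ρ : Vec (V n) k) → comb ρ (normalise e) ≡ ⟦ e ⟧ ρ
normalise-correct v₀       (x ∷ ρ) = trans (cong (x ⊕_) (comb-𝟎 ρ)) (⊕-identityʳ x)
normalise-correct (↑ a)    (x ∷ ρ) = trans (⊕-identityˡ _) (normalise-correct a ρ)
normalise-correct :𝟎       ρ       = comb-𝟎 ρ
normalise-correct (a :⊕ b) ρ       =
  trans (comb-⊕ ρ (normalise a) (normalise b)) (cong₂ _⊕_ (normalise-correct a ρ) (normalise-correct b ρ))

solve : (ρ : Vec (V n) k) (a b : Expr k) → normalise a ≡ normalise b → ⟦ a ⟧ ρ ≡ ⟦ b ⟧ ρ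
solve ρ a b p = trans (sym (normalise-correct a ρ)) (trans (cong (comb ρ) p) (normalise-correct b ρ))

⊕-cancel : (x y : V n) → x ⊕ (x ⊕ y) ≡ y
⊕-cancel x y = solve (x ∷ y ∷ []) (v₀ :⊕ (v₀ :⊕ v₁)) v₁ refl

⊕-cancelʳ : (x y : V n) → (x ⊕ y) ⊕ y ≡ x
⊕-cancelʳ x y = solve (x ∷ y ∷ []) ((v₀ :⊕ v₁) :⊕ v₁) v₀ refl

⊕≡𝟎⇒≡ : (x y : V n) → x ⊕ y ≡ 𝟎 → x ≡ y
⊕≡𝟎⇒≡ x y p = trans (sym (⊕-cancelʳ x y)) (trans (cong (_⊕ y) p) (⊕-identityˡ y))

-- The standard bilinear form identifies V n with its dual.

infix 7 _∙_
_∙_ : V n → V n → Bool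
[]      ∙ []      = false
(a ∷ x) ∙ (b ∷ y) = (a ∧ b) xor (x ∙ y)

xor-interchange : ∀ a b c d → (a xor b) xor (c xor d) ≡ (a xor c) xor (b xor d)
xor-interchange false b false d = refl
xor-interchange false b true  d = sym (Bool.not-distribʳ-xor b d)
xor-interchange true  b false d = sym (Bool.not-distribˡ-xor b d)
xor-interchange true  false true d = Bool.not-involutive d
xor-interchange true  true  true d = refl

∙-⊕ʳ : (x y z : V n) → x ∙ (y ⊕ z) ≡ x ∙ y xor x ∙ z
∙-⊕ʳ []      []      []      = refl
∙-⊕ʳ (a ∷ x) (b ∷ y) (c ∷ z) =
  trans (cong₂ _xor_ (∧-distribˡ-xor a b c) (∙-⊕ʳ x y z)) (xor-interchange (a ∧ b) _ _ _)

∙-comm : (x y : V n) → x ∙ y ≡ y ∙ x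
∙-comm []      []      = refl
∙-comm (a ∷ x) (b ∷ y) = cong₂ _xor_ (∧-comm a b) (∙-comm x y)

∙-⊕ˡ : (x y z : V n) → (x ⊕ y) ∙ z ≡ x ∙ z xor y ∙ z
∙-⊕ˡ x y z = trans (∙-comm (x ⊕ y) z) (trans (∙-⊕ʳ z x y) (cong₂ _xor_ (∙-comm z x) (∙-comm z y)))

∙-𝟎ˡ : (x : V n) → 𝟎 ∙ x ≡ false
∙-𝟎ˡ []      = refl
∙-𝟎ˡ (b ∷ x) = ∙-𝟎ˡ x

∙-𝟎ʳ : (x : V n) → x ∙ 𝟎 ≡ false
∙-𝟎ʳ x = trans (∙-comm x 𝟎) (∙-𝟎ˡ x)

infix 4 _≟_
_≟_ : (x y : V n) → Dec (x ≡ y)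
_≟_ = Vec.≡-dec Bool._≟_

≢𝟎⇒∃∙ : (x : V n) → x ≢ 𝟎 → ∃ λ y → x ∙ y ≡ true
≢𝟎⇒∃∙ []          x≢𝟎 = contradiction refl x≢𝟎
≢𝟎⇒∃∙ (true ∷ x)  _   = true ∷ 𝟎 , cong not (∙-𝟎ʳ x)
≢𝟎⇒∃∙ (false ∷ x) x≢𝟎 with y , p ← ≢𝟎⇒∃∙ x (x≢𝟎 ∘ cong (false ∷_)) = false ∷ y , p

≢𝟎⇒∃∙≡ : (x : V n) → x ≢ 𝟎 → ∀ b → ∃ λ y → x ∙ y ≡ b
≢𝟎⇒∃∙≡ x x≢𝟎 true  = ≢𝟎⇒∃∙ x x≢𝟎
≢𝟎⇒∃∙≡ x x≢𝟎 false = 𝟎 , ∙-𝟎ʳ x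

-- The hyperplane orthogonal to a nonzero vector, parametrised linearly.

hyp : V (suc n) → V n → V (suc n)
hyp (true ∷ x)      u       = x ∙ u ∷ u
hyp (false ∷ x)     []      = 𝟎
hyp (false ∷ x)     (b ∷ u) = b ∷ hyp x u

hyp-lin : (x : V (suc n)) → Linear (hyp x)
hyp-lin (true ∷ x)  u       v       = cong (_∷ (u ⊕ v)) (∙-⊕ʳ x u v)
hyp-lin (false ∷ []) []      []      = refl
hyp-lin (false ∷ x) (a ∷ u) (b ∷ v) = cong ((a xor b) ∷_) (hyp-lin x u v)

hyp-inj : (x : V (suc n)) → x ≢ 𝟎 → ∀ u → hyp x u ≡ 𝟎 → u ≡ 𝟎
hyp-inj (true ∷ x)   _   u       p = Vec.∷-injectiveʳ p
hyp-inj (false ∷ []) x≢𝟎 []      p = refl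
hyp-inj (false ∷ x)  x≢𝟎 (b ∷ u) p =
  cong₂ _∷_ (Vec.∷-injectiveˡ p) (hyp-inj x (x≢𝟎 ∘ cong (false ∷_)) u (Vec.∷-injectiveʳ p))

hyp-∙ : (x : V (suc n)) (u : V n) → x ∙ hyp x u ≡ false
hyp-∙ (true ∷ x)  u       = xor-same (x ∙ u)
hyp-∙ (false ∷ []) []     = refl
hyp-∙ (false ∷ x) (b ∷ u) = hyp-∙ x u

Linear-𝟎 : (f : V m → V n) → Linear f → f 𝟎 ≡ 𝟎
Linear-𝟎 f lin = trans (sym (⊕-cancel (f 𝟎) (f 𝟎)))
  (trans (cong (f 𝟎 ⊕_) (trans (sym (lin 𝟎 𝟎)) (cong f (⊕-self 𝟎)))) (⊕-self (f 𝟎)))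

columns : (V m → V n) → Vec (V n) m
columns {zero}  f = []
columns {suc m} f = f (true ∷ 𝟎) ∷ columns (f ∘ (false ∷_))

comb-columns : (f : V m → V n) → Linear f → ∀ u → comb (columns f) u ≡ f u
comb-columns f lin []          = sym (Linear-𝟎 f lin)
comb-columns f lin (true ∷ u)  = trans (cong (f (true ∷ 𝟎) ⊕_) (comb-columns (f ∘ (false ∷_)) (λ x y → lin _ _) u))
  (trans (sym (lin _ _)) (cong (f ∘ (true ∷_)) (⊕-identityˡ u)))
comb-columns f lin (false ∷ u) = trans (⊕-identityˡ _) (comb-columns (f ∘ (false ∷_)) (λ x y → lin _ _) u)

-- Exhaustive search

any? : {P : V n → Set} → (∀ v → Dec (P v)) → Dec (∃ P)
any? {zero}  P? = map′ ([] ,_) (λ { ([] , p) → p }) (P? [])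
any? {suc n} P? = map′
  [ (λ (v , p) → true ∷ v , p) , (λ (v , p) → false ∷ v , p) ]′
  (λ { (true ∷ v , p) → inj₁ (v , p) ; (false ∷ v , p) → inj₂ (v , p) })
  (any? (P? ∘ (true ∷_)) ⊎-dec any? (P? ∘ (false ∷_)))

∄¬⇒∀ : {P : V n → Set} → (∀ v → Dec (P v)) → ¬ (∃ λ v → ¬ P v) → ∀ v → P v
∄¬⇒∀ P? ∄ v = decidable-stable (P? v) (λ ¬p → ∄ (v , ¬p))

all? : {P : V n → Set} → (∀ v → Dec (P v)) → Dec (∀ v → P v)
all? P? = map′ (∄¬⇒∀ P?) (λ f (v , ¬p) → ¬p (f v)) (¬? (any? (¬? ∘ P?)))

¬∀⇒∃¬ : {P : V n → Set} → (∀ v → Dec (P v)) → ¬ (∀ v → P v) → ∃ λ v → ¬ P v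
¬∀⇒∃¬ P? ¬∀ = decidable-stable (any? (¬? ∘ P?)) (¬∀ ∘ ∄¬⇒∀ P?)

anyᵛ? : {P : Vec (V n) k → Set} → (∀ g → Dec (P g)) → Dec (∃ P)
anyᵛ? {k = zero}  P? = map′ ([] ,_) (λ { ([] , p) → p }) (P? [])
anyᵛ? {k = suc k} P? = map′ (λ (x , g , p) → x ∷ g , p) (λ { (x ∷ g , p) → x , g , p })
  (any? (λ x → anyᵛ? (P? ∘ (x ∷_))))

-- `2 ^ n`, written by doubling so that it matches the two halves of `allV` definitionally.
size : ℕ → ℕ
size zero    = 1
size (suc n) = size n + size n

allV : ∀ n → Vec (V n) (size n)
allV zero    = [] ∷ []
allV (suc n) = map (true ∷_) (allV n) ++ map (false ∷_) (allV n)

∈-allV : (v : V n) → v ∈ allV n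
∈-allV []          = here refl
∈-allV (true ∷ v)  = ∈-++⁺ˡ (∈-map⁺ (true ∷_) (∈-allV v))
∈-allV (false ∷ v) = ∈-++⁺ʳ (map (true ∷_) (allV _)) (∈-map⁺ (false ∷_) (∈-allV v))

map-≡⇒ : {A B : Set} (f g : A → B) {xs : Vec A k} → map f xs ≡ map g xs → ∀ {x} → x ∈ xs → f x ≡ g x
map-≡⇒ f g p (here refl) = Vec.∷-injectiveˡ p
map-≡⇒ f g p (there x∈)  = map-≡⇒ f g (Vec.∷-injectiveʳ p) x∈

-- Counting

bit : Bool → ℕ
bit true  = 1
bit false = 0

countᵇ : (V n → Bool) → ℕ
countᵇ {zero}  f = bit (f [])
countᵇ {suc n} f = countᵇ (f ∘ (true ∷_)) + countᵇ (f ∘ (false ∷_))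

countᵇ-+-mono : (f f′ g g′ : V n → Bool) → (∀ v → bit (f v) + bit (f′ v) ≤ bit (g v) + bit (g′ v)) →
                countᵇ f + countᵇ f′ ≤ countᵇ g + countᵇ g′
countᵇ-+-mono {zero}  f f′ g g′ h = h []
countᵇ-+-mono {suc n} f f′ g g′ h = subst₂ _≤_
  (swap (countᵇ (f ∘ (true ∷_))) _ _ _) (swap (countᵇ (g ∘ (true ∷_))) _ _ _)
  (ℕ.+-mono-≤ (countᵇ-+-mono _ _ _ _ (h ∘ (true ∷_))) (countᵇ-+-mono _ _ _ _ (h ∘ (false ∷_))))
  where
  open +-*-Solver renaming (solve to ℕ-solve)
  swap : ∀ a b c d → (a + b) + (c + d) ≡ (a + c) + (b + d)
  swap = ℕ-solve 4 (λ a b c d → (a :+ b) :+ (c :+ d) := (a :+ c) :+ (b :+ d)) refl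

countᵇ-mono : (f g : V n → Bool) → (∀ v → f v ≡ true → g v ≡ true) → countᵇ f ≤ countᵇ g
countᵇ-mono {zero}  f g h with f [] in p
... | true  rewrite h [] p = ℕ.≤-refl
... | false = z≤n
countᵇ-mono {suc n} f g h = ℕ.+-mono-≤ (countᵇ-mono _ _ (h ∘ (true ∷_))) (countᵇ-mono _ _ (h ∘ (false ∷_)))

countᵇ-strict : (f g : V n → Bool) → (∀ v → f v ≡ true → g v ≡ true) →
                ∀ v → f v ≡ false → g v ≡ true → countᵇ f < countᵇ g
countᵇ-strict f g h []          p q rewrite p | q = s≤s z≤n
countᵇ-strict f g h (true ∷ v)  p q =
  ℕ.+-mono-<-≤ (countᵇ-strict _ _ (h ∘ (true ∷_)) v p q) (countᵇ-mono _ _ (h ∘ (false ∷_)))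
countᵇ-strict f g h (false ∷ v) p q =
  ℕ.+-mono-≤-< (countᵇ-mono _ _ (h ∘ (true ∷_))) (countᵇ-strict _ _ (h ∘ (false ∷_)) v p q)

countᵇ-shift : (f : V n → Bool) (w : V n) → countᵇ (λ v → f (v ⊕ w)) ≡ countᵇ f
countᵇ-shift f []          = refl
countᵇ-shift f (true ∷ w)  = trans
  (cong₂ _+_ (countᵇ-shift (f ∘ (false ∷_)) w) (countᵇ-shift (f ∘ (true ∷_)) w)) (ℕ.+-comm (countᵇ (f ∘ (false ∷_))) _)
countᵇ-shift f (false ∷ w) = cong₂ _+_ (countᵇ-shift (f ∘ (true ∷_)) w) (countᵇ-shift (f ∘ (false ∷_)) w)

does⇒ : {P : Set} (d : Dec P) → does d ≡ true → P
does⇒ (yes p) _ = p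

abstract
  count : {P : V n → Set} → (∀ v → Dec (P v)) → ℕ
  count P? = countᵇ (λ v → does (P? v))

module _ {P Q : V n → Set} (P? : ∀ v → Dec (P v)) (Q? : ∀ v → Dec (Q v)) where

  abstract
    count-mono : (∀ v → P v → Q v) → count P? ≤ count Q?
    count-mono h = countᵇ-mono _ _ (λ v p → dec-true (Q? v) (h v (does⇒ (P? v) p)))

    count-strict : (∀ v → P v → Q v) → ∀ v → ¬ P v → Q v → count P? < count Q?
    count-strict h v ¬p q = countᵇ-strict _ _ (λ v p → dec-true (Q? v) (h v (does⇒ (P? v) p)))
      v (dec-false (P? v) ¬p) (dec-true (Q? v) q)

    count-⊈ : count Q? < count P? → ∃ λ v → P v × ¬ Q v
    count-⊈ lt with any? (λ v → P? v ×-dec ¬? (Q? v))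
    ... | yes e = e
    ... | no ∄  = contradiction lt (ℕ.≤⇒≯ (count-mono (λ v p → decidable-stable (Q? v) (λ ¬q → ∄ (v , p , ¬q)))))

    -- Each pair `v`, `v ⊕ w` contains at most one element of `P`, and if one, then at least one of
    -- `Q`. Summing over all `v` counts every pair twice.
    count-coset : (w : V n) → (∀ v → P v → ¬ P (v ⊕ w)) → (∀ v → P v → Q v ⊎ Q (v ⊕ w)) → count P? ≤ count Q?
    count-coset w disj cover = ℕ.*-cancelˡ-≤ 2 (subst₂ _≤_ (two (count P?)) (two (count Q?)) doubled)
      where
      two : ∀ a → a + a ≡ 2 * a
      two a = cong (a +_) (sym (ℕ.+-identityʳ a))
      pointwise : ∀ v → bit (does (P? v)) + bit (does (P? (v ⊕ w))) ≤ bit (does (Q? v)) + bit (does (Q? (v ⊕ w)))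
      pointwise v with P? v | P? (v ⊕ w) | Q? v | Q? (v ⊕ w)
      ... | yes p | yes p′ | _     | _     = contradiction p′ (disj v p)
      ... | yes p | no _   | yes _ | _     = s≤s z≤n
      ... | yes p | no _   | no _  | yes _ = s≤s z≤n
      ... | yes p | no _   | no ¬q | no ¬q′ = ⊥-elim ([ ¬q , ¬q′ ]′ (cover v p))
      ... | no _  | yes p  | yes _ | _     = s≤s z≤n
      ... | no _  | yes p  | no _  | yes _ = s≤s z≤n
      ... | no _  | yes p  | no ¬q | no ¬q′ = ⊥-elim ([ ¬q′ , (λ q → ¬q (subst Q (⊕-cancelʳ v w) q)) ]′ (cover (v ⊕ w) p))
      ... | no _  | no _   | _     | _     = z≤n
      doubled : count P? + count P? ≤ count Q? + count Q?
      doubled = subst₂ _≤_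
        (cong (count P? +_) (countᵇ-shift (λ v → does (P? v)) w)) (cong (count Q? +_) (countᵇ-shift (λ v → does (Q? v)) w))
        (countᵇ-+-mono _ _ _ _ pointwise)

-- Pigeonhole: with vectors coded as numbers, a section of `f` would inject `Fin (size n)` into a
-- smaller set.
surjective⇒≤ : (f : V k → V n) → (∀ y → ∃ λ x → f x ≡ y) → n ≤ k
surjective⇒≤ {k} {n} f surj = ℕ.≮⇒≥ (λ k<n → ℕ.<⇒≱ (size-mono-< k<n) (injective⇒≤ {f = g} g-inj))
  where
  size≥1 : ∀ m → 1 ≤ size m
  size≥1 zero    = s≤s z≤n
  size≥1 (suc m) = ℕ.≤-trans (size≥1 m) (ℕ.m≤m+n _ _)
  size-mono-< : ∀ {a b} → a < b → size a < size b
  size-mono-< {zero}  {suc b} _         = ℕ.+-mono-≤ (size≥1 b) (size≥1 b)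
  size-mono-< {suc a} {suc b} (s≤s a<b) = ℕ.+-mono-< (size-mono-< a<b) (size-mono-< a<b)
  code : ∀ m → V m → Fin (size m)
  code zero    []          = zero
  code (suc m) (true ∷ v)  = join (size m) _ (inj₁ (code m v))
  code (suc m) (false ∷ v) = join (size m) _ (inj₂ (code m v))
  decode : ∀ m → Fin (size m) → V m
  decode zero    _ = []
  decode (suc m) i = [ (λ j → true ∷ decode m j) , (λ j → false ∷ decode m j) ]′ (splitAt (size m) i)
  decode-code : ∀ m v → decode m (code m v) ≡ v
  decode-code zero    []          = refl
  decode-code (suc m) (true ∷ v)
    rewrite splitAt-join (size m) (size m) (inj₁ (code m v)) = cong (true ∷_) (decode-code m v)
  decode-code (suc m) (false ∷ v)
    rewrite splitAt-join (size m) (size m) (inj₂ (code m v)) = cong (false ∷_) (decode-code m v)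
  code-decode : ∀ m i → code m (decode m i) ≡ i
  code-decode zero    zero = refl
  code-decode (suc m) i with splitAt (size m) i | join-splitAt (size m) (size m) i
  ... | inj₁ j | p = trans (cong (λ c → join (size m) _ (inj₁ c)) (code-decode m j)) p
  ... | inj₂ j | p = trans (cong (λ c → join (size m) _ (inj₂ c)) (code-decode m j)) p
  section : V n → V k
  section y = proj₁ (surj y)
  g : Fin (size n) → Fin (size k)
  g c = code k (section (decode n c))
  g-inj : ∀ {c d} → g c ≡ g d → c ≡ d
  g-inj {c} {d} p = trans (sym (code-decode n c)) (trans (cong (code n) same) (code-decode n d))
    where
    same : decode n c ≡ decode n d
    same = trans (sym (proj₂ (surj _))) (trans
      (cong f (trans (sym (decode-code k _)) (trans (cong (decode k) p) (decode-code k _)))) (proj₂ (surj _)))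

-- Subspaces

record Sub (n : ℕ) : Set₁ where
  infix 4 _∋_
  field
    _∋_    : V n → Set
    _∋?_   : ∀ v → Dec (_∋_ v)
    ∋-𝟎    : _∋_ 𝟎
    ∋-⊕    : ∀ {x y} → _∋_ x → _∋_ y → _∋_ (x ⊕ y)
open Sub public

infix 4 _⊆_
_⊆_ : Sub n → Sub n → Set
A ⊆ B = ∀ {v} → A ∋ v → B ∋ v

∋-cancelʳ : (A : Sub n) {x y : V n} → A ∋ y → A ∋ x ⊕ y → A ∋ x
∋-cancelʳ A {x} {y} y∈ xy∈ = subst (A ∋_) (⊕-cancelʳ x y) (∋-⊕ A xy∈ y∈)

∋-cancelˡ : (A : Sub n) {x y : V n} → A ∋ x → A ∋ x ⊕ y → A ∋ y
∋-cancelˡ A {x} {y} x∈ xy∈ = subst (A ∋_) (⊕-cancel x y) (∋-⊕ A x∈ xy∈)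

⊤ˢ : Sub n
⊤ˢ {n} = record { _∋_ = λ v → v ≡ v ; _∋?_ = λ v → yes refl ; ∋-𝟎 = refl ; ∋-⊕ = λ _ _ → refl }

⊥ˢ : Sub n
⊥ˢ = record { _∋_ = _≡ 𝟎 ; _∋?_ = _≟ 𝟎 ; ∋-𝟎 = refl ; ∋-⊕ = λ { refl refl → ⊕-self 𝟎 } }

image : Vec (V n) k → Sub n
image g = record
  { _∋_  = λ v → ∃ λ u → comb g u ≡ v
  ; _∋?_ = λ v → any? (λ u → comb g u ≟ v)
  ; ∋-𝟎  = 𝟎 , comb-𝟎 g
  ; ∋-⊕  = λ { (u , refl) (v , refl) → u ⊕ v , comb-⊕ g u v }
  }

infixl 6 _⊞_
_⊞_ : Sub n → Sub n → Sub n
A ⊞ B = record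
  { _∋_  = λ v → ∃₂ λ a b → A ∋ a × B ∋ b × a ⊕ b ≡ v
  ; _∋?_ = λ v → any? (λ a → any? (λ b → (A ∋? a) ×-dec (B ∋? b) ×-dec (a ⊕ b ≟ v)))
  ; ∋-𝟎  = 𝟎 , 𝟎 , ∋-𝟎 A , ∋-𝟎 B , ⊕-self 𝟎
  ; ∋-⊕  = λ { (a , b , a∈ , b∈ , refl) (a′ , b′ , a′∈ , b′∈ , refl) →
      a ⊕ a′ , b ⊕ b′ , ∋-⊕ A a∈ a′∈ , ∋-⊕ B b∈ b′∈ , ⊕-interchange a a′ b b′ }
  }

⊞-inˡ : (A B : Sub n) → A ⊆ A ⊞ B
⊞-inˡ A B {v} v∈ = v , 𝟎 , v∈ , ∋-𝟎 B , ⊕-identityʳ v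

⊞-inʳ : (A B : Sub n) → B ⊆ A ⊞ B
⊞-inʳ A B {v} v∈ = 𝟎 , v , ∋-𝟎 A , v∈ , ⊕-identityˡ v

⊞-⊆ : (A B C : Sub n) → A ⊆ C → B ⊆ C → A ⊞ B ⊆ C
⊞-⊆ A B C A⊆C B⊆C (a , b , a∈ , b∈ , refl) = ∋-⊕ C (A⊆C a∈) (B⊆C b∈)

_∩ˢ_ : Sub n → Sub n → Sub n
A ∩ˢ B = record
  { _∋_  = λ v → A ∋ v × B ∋ v
  ; _∋?_ = λ v → (A ∋? v) ×-dec (B ∋? v)
  ; ∋-𝟎  = ∋-𝟎 A , ∋-𝟎 B
  ; ∋-⊕  = λ (a , b) (a′ , b′) → ∋-⊕ A a a′ , ∋-⊕ B b b′
  }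

module _ {P : V n → Set} (P? : ∀ v → Dec (P v)) where

  private
    filtered : V n → V n
    filtered v = if does (P? v) then v else 𝟎

  abstract
    -- Vectors outside `P` are replaced by `𝟎` instead of being removed, which keeps the list at a
    -- fixed length; `image` then supplies decidable membership.
    span : Sub n
    span = image (map filtered (allV n))

    span-gen : ∀ {v} → P v → span ∋ v
    span-gen {v} p with P? v | comb-∈ (∈-map⁺ filtered (∈-allV v))
    ... | yes _ | u , q = u , q
    ... | no ¬p | _ = contradiction p ¬p

    span-ind : (Q : V n → Set) → Q 𝟎 → (∀ {v x} → P v → Q x → Q (v ⊕ x)) → ∀ {x} → span ∋ x → Q x
    span-ind Q Q𝟎 Q⊕ (u , refl) = go (allV n) u
      where
      go : ∀ {k} (xs : Vec (V n) k) u → Q (comb (map filtered xs) u)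
      go []       []          = Q𝟎
      go (x ∷ xs) (false ∷ u) = subst Q (sym (⊕-identityˡ _)) (go xs u)
      go (x ∷ xs) (true ∷ u) with P? x
      ... | yes p = Q⊕ p (go xs u)
      ... | no _  = subst Q (sym (⊕-identityˡ _)) (go xs u)

headless : Sub (suc n) → Sub n
headless D = record { _∋_ = λ v → D ∋ false ∷ v ; _∋?_ = λ v → D ∋? (false ∷ v) ; ∋-𝟎 = ∋-𝟎 D ; ∋-⊕ = ∋-⊕ D }

-- The functional is built coordinate by coordinate. If `D` contains some `true ∷ u`, its first
-- entry must be `x ∙ u`, and `u` serves to clear the head of `w` before the recursive call.
separate : (D : Sub n) (w : V n) → ¬ D ∋ w → ∃ λ x → (∀ {d} → D ∋ d → x ∙ d ≡ false) × x ∙ w ≡ true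
separate {zero}  D []      w∉ = contradiction (∋-𝟎 D) w∉
separate {suc n} D (b ∷ w) w∉ with any? (λ u → D ∋? (true ∷ u))
... | yes (u , u∈) = x ∙ u ∷ x , kills , trans (cong (_xor x ∙ w) (∧-comm (x ∙ u) b)) lifted
  where
  D₀ : Sub n
  D₀ = headless D
  w∉D₀ : ¬ D₀ ∋ b · u ⊕ w
  w∉D₀ = reduce b w∉
    where
    reduce : ∀ b → ¬ D ∋ b ∷ w → ¬ D₀ ∋ b · u ⊕ w
    reduce true  w∉ q = w∉ (subst (λ v → D ∋ true ∷ v) (⊕-cancel u w) (∋-⊕ D u∈ q))
    reduce false w∉ q = w∉ (subst (λ v → D ∋ false ∷ v) (⊕-identityˡ w) q)
  x : V n
  x = proj₁ (separate D₀ _ w∉D₀)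
  x-kills : ∀ {d} → D₀ ∋ d → x ∙ d ≡ false
  x-kills = proj₁ (proj₂ (separate D₀ _ w∉D₀))
  kills : ∀ {d} → D ∋ d → (x ∙ u ∷ x) ∙ d ≡ false
  kills {false ∷ d} d∈ = trans (cong (_xor x ∙ d) (Bool.∧-zeroʳ (x ∙ u))) (x-kills d∈)
  kills {true ∷ d}  d∈ = trans (cong (_xor x ∙ d) (Bool.∧-identityʳ (x ∙ u)))
    (trans (sym (∙-⊕ʳ x u d)) (x-kills (∋-⊕ D u∈ d∈)))
  lifted : (b ∧ x ∙ u) xor x ∙ w ≡ true
  lifted = trans (cong (_xor x ∙ w) (scale b)) (trans (sym (∙-⊕ʳ x (b · u) w)) (proj₂ (proj₂ (separate D₀ _ w∉D₀))))
    where
    scale : ∀ b → b ∧ x ∙ u ≡ x ∙ (b · u)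
    scale true  = refl
    scale false = sym (∙-𝟎ʳ x)
separate {suc n} D (true ∷ w) w∉ | no ∄u = true ∷ 𝟎 , kills , cong not (∙-𝟎ˡ w)
  where
  kills : ∀ {d} → D ∋ d → (true ∷ 𝟎) ∙ d ≡ false
  kills {true ∷ d}  d∈ = contradiction (d , d∈) ∄u
  kills {false ∷ d} d∈ = ∙-𝟎ˡ d
separate {suc n} D (false ∷ w) w∉ | no ∄u = false ∷ x , kills , x∙w
  where
  D₀ : Sub n
  D₀ = headless D
  x : V n
  x = proj₁ (separate D₀ w w∉)
  x∙w : x ∙ w ≡ true
  x∙w = proj₂ (proj₂ (separate D₀ w w∉))
  kills : ∀ {d} → D ∋ d → (false ∷ x) ∙ d ≡ false
  kills {true ∷ d}  d∈ = contradiction (d , d∈) ∄u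
  kills {false ∷ d} d∈ = proj₁ (proj₂ (separate D₀ w w∉)) d∈

-- Bases and complements

Independent : Vec (V n) k → Set
Independent g = ∀ u → comb g u ≡ 𝟎 → u ≡ 𝟎

module _ (S : Sub n) (g : Vec (V n) k) (g-ind : Independent g) (g⊆S : ∀ u → S ∋ comb g u) where

  record Extension : Set where
    field
      {dim}   : ℕ
      vectors : Vec (V n) dim
      inside  : ∀ y → S ∋ comb vectors y
      indep   : ∀ u y → comb g u ⊕ comb vectors y ≡ 𝟎 → u ≡ 𝟎 × y ≡ 𝟎
      spans   : ∀ {v} → S ∋ v → ∃₂ λ u y → comb g u ⊕ comb vectors y ≡ v

  abstract
    -- Greedy completion to a basis; the fuel is the number of vectors of `S` not yet spanned.
    extend : Extension
    extend = go (count (outside? [])) [] ℕ.≤-refl (λ { [] → ∋-𝟎 S })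
      (λ { u [] p → g-ind u (trans (sym (⊕-identityʳ _)) p) , refl })
      where
      Spanned : ∀ {l} → Vec (V n) l → V n → Set
      Spanned h v = ∃₂ λ u y → comb g u ⊕ comb h y ≡ v
      spanned? : ∀ {l} (h : Vec (V n) l) v → Dec (Spanned h v)
      spanned? h v = any? (λ u → any? (λ y → comb g u ⊕ comb h y ≟ v))
      outside? : ∀ {l} (h : Vec (V n) l) v → Dec (S ∋ v × ¬ Spanned h v)
      outside? h v = (S ∋? v) ×-dec ¬? (spanned? h v)
      go : ∀ fuel {l} (h : Vec (V n) l) → count (outside? h) ≤ fuel → (∀ y → S ∋ comb h y) →
           (∀ u y → comb g u ⊕ comb h y ≡ 𝟎 → u ≡ 𝟎 × y ≡ 𝟎) → Extension
      go fuel h h≤ h⊆S h-ind with any? (outside? h)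
      ... | no ∄v = record { vectors = h ; inside = h⊆S ; indep = h-ind
                           ; spans = λ {v} v∈ → decidable-stable (spanned? h v) (λ ¬sp → ∄v (v , v∈ , ¬sp)) }
      ... | yes (v , v∈ , v∉) = descend fuel (ℕ.<-≤-trans shrinks h≤)
        where
        weaken : ∀ {w} → Spanned h w → Spanned (v ∷ h) w
        weaken (u , y , p) = u , false ∷ y , trans (cong (comb g u ⊕_) (⊕-identityˡ _)) p
        v-spanned : Spanned (v ∷ h) v
        v-spanned = 𝟎 , true ∷ 𝟎 , trans (cong₂ (λ a b → a ⊕ (v ⊕ b)) (comb-𝟎 g) (comb-𝟎 h))
          (trans (⊕-identityˡ _) (⊕-identityʳ v))
        shrinks : count (outside? (v ∷ h)) < count (outside? h)
        shrinks = count-strict (outside? (v ∷ h)) (outside? h) (λ w (w∈ , ¬sp) → w∈ , ¬sp ∘ weaken)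
          v (λ (_ , ¬sp) → ¬sp v-spanned) (v∈ , v∉)
        vh⊆S : ∀ y → S ∋ comb (v ∷ h) y
        vh⊆S (true ∷ y)  = ∋-⊕ S v∈ (h⊆S y)
        vh⊆S (false ∷ y) = ∋-⊕ S (∋-𝟎 S) (h⊆S y)
        vh-ind : ∀ u y → comb g u ⊕ comb (v ∷ h) y ≡ 𝟎 → u ≡ 𝟎 × y ≡ 𝟎
        vh-ind u (true ∷ y) p = contradiction (u , y , sym (⊕≡𝟎⇒≡ v _ (trans rearrange p))) v∉
          where
          rearrange : v ⊕ (comb g u ⊕ comb h y) ≡ comb g u ⊕ (v ⊕ comb h y)
          rearrange = solve (v ∷ comb g u ∷ comb h y ∷ []) (v₀ :⊕ (v₁ :⊕ v₂)) (v₁ :⊕ (v₀ :⊕ v₂)) refl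
        vh-ind u (false ∷ y) p with refl , refl ← h-ind u y (trans (cong (comb g u ⊕_) (sym (⊕-identityˡ _))) p) = refl , refl
        descend : ∀ fuel → count (outside? (v ∷ h)) < fuel → Extension
        descend (suc fuel) (s≤s lt) = go fuel (v ∷ h) lt vh⊆S vh-ind

record Complement (A B : Sub n) : Set₁ where
  field
    space    : Sub n
    inside   : space ⊆ B
    disjoint : ∀ {v} → A ∋ v → space ∋ v → v ≡ 𝟎
    covers   : B ⊆ A ⊞ space

[]-independent : Independent {n} []
[]-independent [] _ = refl

[]-⊆ : (A : Sub n) (u : V 0) → A ∋ comb [] u
[]-⊆ A [] = ∋-𝟎 A

basis : (A : Sub n) → Extension A [] []-independent ([]-⊆ A)
basis A = extend A [] []-independent ([]-⊆ A)

abstract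
  directComplement : (A B : Sub n) → A ⊆ B → Complement A B
  directComplement A B A⊆B = record
    { space    = image H.vectors
    ; inside   = λ { (y , refl) → H.inside y }
    ; disjoint = disj
    ; covers   = λ v∈ → let u , y , p = H.spans v∈ in _ , _ , G.inside u , (y , refl) , p
    }
    where
    module G = Extension (basis A)
    G-ind : Independent G.vectors
    G-ind u p = proj₂ (G.indep [] u (trans (⊕-identityˡ _) p))
    module H = Extension (extend B G.vectors G-ind (λ u → A⊆B (G.inside u)))
    disj : ∀ {v} → A ∋ v → image H.vectors ∋ v → v ≡ 𝟎
    disj {v} v∈ (y , q) = from-spans (G.spans v∈)
      where
      from-spans : (∃₂ λ u₀ u → comb [] u₀ ⊕ comb G.vectors u ≡ v) → v ≡ 𝟎
      from-spans ([] , u , p) = trans (sym q) (trans (cong (comb H.vectors) (proj₂ (H.indep u y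
        (trans (cong₂ _⊕_ (trans (sym (⊕-identityˡ _)) p) q) (⊕-self v))))) (comb-𝟎 H.vectors))

-- The k vectors span B modulo A; A need not be contained in B.
Codim≤ : ℕ → Sub n → Sub n → Set
Codim≤ {n} k A B = Σ (Vec (V n) k) λ g → ∀ {v} → B ∋ v → ∃ λ u → A ∋ v ⊕ comb g u

codim-⊆ : {A B : Sub n} → B ⊆ A → Codim≤ 0 A B
codim-⊆ {A = A} B⊆A = [] , λ {v} v∈ → [] , subst (A ∋_) (sym (⊕-identityʳ v)) (B⊆A v∈)

codim-trans : (A : Sub n) {B C : Sub n} → Codim≤ k A B → Codim≤ l B C → Codim≤ (k + l) A C
codim-trans A (g , g-cov) (h , h-cov) = g ++ h , λ {v} v∈ →
  let y , p = h-cov v∈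
      x , q = g-cov p
  in x ++ y , subst (A ∋_) (trans (solve (v ∷ comb g x ∷ comb h y ∷ []) ((v₀ :⊕ v₂) :⊕ v₁) (v₀ :⊕ (v₁ :⊕ v₂)) refl)
       (cong (v ⊕_) (sym (comb-++′ g h x y)))) q

codim-⊞ : (A A′ : Sub n) {B B′ : Sub n} → Codim≤ k A B → Codim≤ l A′ B′ → Codim≤ (k + l) (A ⊞ A′) (B ⊞ B′)
codim-⊞ A A′ (g , g-cov) (h , h-cov) = g ++ h , λ { (b , b′ , b∈ , b′∈ , refl) →
  let x , p = g-cov b∈
      y , q = h-cov b′∈
  in x ++ y , (_ , _ , p , q , trans (⊕-interchange b (comb g x) b′ (comb h y)) (cong ((b ⊕ b′) ⊕_) (sym (comb-++′ g h x y)))) }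

codim-mono : (A : Sub n) {B : Sub n} → k ≤ l → Codim≤ k A B → Codim≤ l A B
codim-mono {k = k} {l} A {B} k≤l A≤B =
  subst (λ j → Codim≤ j A B) (ℕ.m∸n+n≡m k≤l) (codim-trans A {A} {B} (padding (l ∸ k)) A≤B)
  where
  padding : ∀ j → Codim≤ j A A
  padding j = replicate j 𝟎 , λ {v} v∈ → 𝟎 , subst (A ∋_)
    (sym (trans (cong (v ⊕_) (comb-𝟎 (replicate j 𝟎))) (⊕-identityʳ v))) v∈

-- Cliques: tuples of independent vectors spanning a subspace disjoint from E

true≢false : ∀ {b} → b ≡ true → b ≢ false
true≢false refl ()

-- Claw-freeness without an independence hypothesis: dependent a, b, c satisfy the
-- implication automatically.
NoClaw : (V n → Bool) → Set
NoClaw E = ∀ a b c → E a ≡ true → E b ≡ true → E c ≡ true →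
           E (a ⊕ b) ≡ false → E (a ⊕ c) ≡ false → E (b ⊕ c) ≡ false → E (a ⊕ b ⊕ c) ≡ true

injective-from-kernel : {f : V m → V n} → Linear f → (∀ x → f x ≡ 𝟎 → x ≡ 𝟎) → ∀ x y → f x ≡ f y → x ≡ y
injective-from-kernel {f = f} lin ker x y p =
  ⊕≡𝟎⇒≡ x y (ker (x ⊕ y) (trans (lin x y) (trans (cong (_⊕ f y) p) (⊕-self (f y)))))

clawFree⇒noClaw : (M : Matroid n) → ClawFree M → NoClaw (E M)
clawFree⇒noClaw {n} M cf a b c a∈ b∈ c∈ ab∉ ac∉ bc∉ = ¬-not λ abc∉ → claw abc∉
  where
  ρ : Vec (V n) 3
  ρ = a ∷ b ∷ c ∷ []
  claw : E M (a ⊕ b ⊕ c) ≢ false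
  claw abc∉ = cf ψ (restrict M ψ) isClaw (record
    { to = id ; from = id ; to-lin = λ _ _ → refl ; from-to = λ _ → refl ; to-from = λ _ → refl ; preserves = λ _ → refl })
    where
    value : (e : Expr 3) {x : Bool} → E M (⟦ e ⟧ ρ) ≡ x → E M (comb ρ (normalise e)) ≡ x
    value e p = trans (cong (E M) (normalise-correct e ρ)) p
    a-in : E M (comb ρ (true ∷ false ∷ false ∷ [])) ≡ true
    a-in = value v₀ a∈
    b-in : E M (comb ρ (false ∷ true ∷ false ∷ [])) ≡ true
    b-in = value v₁ b∈
    c-in : E M (comb ρ (false ∷ false ∷ true ∷ [])) ≡ true
    c-in = value v₂ c∈
    merge : (e e′ e″ : Expr 3) {x : Bool} → normalise e ≡ normalise (e′ :⊕ e″) → comb ρ (normalise e) ≡ 𝟎 →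
            E M (⟦ e′ ⟧ ρ) ≡ x → E M (⟦ e″ ⟧ ρ) ≡ x
    merge e e′ e″ q p = subst (λ v → E M v ≡ _) (⊕≡𝟎⇒≡ _ _ (trans (sym (solve ρ e (e′ :⊕ e″) q)) (trans (sym (normalise-correct e ρ)) p)))
    -- A vanishing combination would put `𝟎` into `E` or identify two vectors on which `E` takes
    -- opposite values.
    kernel : ∀ u → comb ρ u ≡ 𝟎 → u ≡ 𝟎
    kernel (false ∷ false ∷ false ∷ []) p = refl
    kernel (true  ∷ false ∷ false ∷ []) p = contradiction (E-𝟎 M) (true≢false (trans (cong (E M) (sym p)) a-in))
    kernel (false ∷ true  ∷ false ∷ []) p = contradiction (E-𝟎 M) (true≢false (trans (cong (E M) (sym p)) b-in))
    kernel (false ∷ false ∷ true  ∷ []) p = contradiction (E-𝟎 M) (true≢false (trans (cong (E M) (sym p)) c-in))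
    kernel (true  ∷ true  ∷ false ∷ []) p =
      contradiction abc∉ (true≢false (merge (v₀ :⊕ v₁) v₂ ((v₀ :⊕ v₁) :⊕ v₂) refl p c∈))
    kernel (true  ∷ false ∷ true  ∷ []) p =
      contradiction abc∉ (true≢false (merge (v₀ :⊕ v₂) v₁ ((v₀ :⊕ v₁) :⊕ v₂) refl p b∈))
    kernel (false ∷ true  ∷ true  ∷ []) p =
      contradiction abc∉ (true≢false (merge (v₁ :⊕ v₂) v₀ ((v₀ :⊕ v₁) :⊕ v₂) refl p a∈))
    kernel (true  ∷ true  ∷ true  ∷ []) p =
      contradiction ab∉ (true≢false (merge ((v₀ :⊕ v₁) :⊕ v₂) v₂ (v₀ :⊕ v₁) refl p c∈))
    ψ : Flat 3 n
    ψ = record { emb = comb ρ ; emb-lin = comb-⊕ ρ ; emb-inj = injective-from-kernel (comb-⊕ ρ) kernel }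
    isClaw : IsClaw (restrict M ψ)
    isClaw = true ∷ false ∷ false ∷ [] , false ∷ true ∷ false ∷ [] , false ∷ false ∷ true ∷ [] , basis3 , λ x → mk⇔ (to x) from
      where
      basis3 : Basis3 _ _ _
      basis3 false false false _ = refl , refl , refl
      basis3 false false true  ()
      basis3 false true  false ()
      basis3 false true  true  ()
      basis3 true  false false ()
      basis3 true  false true  ()
      basis3 true  true  false ()
      basis3 true  true  true  ()
      to : ∀ x → E M (comb ρ x) ≡ true →
           x ≡ true ∷ false ∷ false ∷ [] ⊎ x ≡ false ∷ true ∷ false ∷ [] ⊎ x ≡ false ∷ false ∷ true ∷ []
      to (true  ∷ false ∷ false ∷ []) _ = inj₁ refl
      to (false ∷ true  ∷ false ∷ []) _ = inj₂ (inj₁ refl)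
      to (false ∷ false ∷ true  ∷ []) _ = inj₂ (inj₂ refl)
      to (false ∷ false ∷ false ∷ []) p = contradiction (value :𝟎 (E-𝟎 M)) (true≢false p)
      to (true  ∷ true  ∷ false ∷ []) p = contradiction (value (v₀ :⊕ v₁) ab∉) (true≢false p)
      to (true  ∷ false ∷ true  ∷ []) p = contradiction (value (v₀ :⊕ v₂) ac∉) (true≢false p)
      to (false ∷ true  ∷ true  ∷ []) p = contradiction (value (v₁ :⊕ v₂) bc∉) (true≢false p)
      to (true  ∷ true  ∷ true  ∷ []) p = contradiction (value (v₀ :⊕ v₁ :⊕ v₂) abc∉) (true≢false p)
      from : ∀ {x} → x ≡ true ∷ false ∷ false ∷ [] ⊎ x ≡ false ∷ true ∷ false ∷ [] ⊎ x ≡ false ∷ false ∷ true ∷ [] →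
             E M (comb ρ x) ≡ true
      from (inj₁ refl)        = a-in
      from (inj₂ (inj₁ refl)) = b-in
      from (inj₂ (inj₂ refl)) = c-in

module _ (E : V n → Bool) where

  IsClique : Sub n → Vec (V n) k → Set
  IsClique S g = ∀ u → u ≢ 𝟎 → S ∋ comb g u × comb g u ≢ 𝟎 × E (comb g u) ≡ false

  HasClique : Sub n → ℕ → Set
  HasClique S k = ∃ λ (g : Vec (V n) k) → IsClique S g

  hasClique? : ∀ S k → Dec (HasClique S k)
  hasClique? S k = anyᵛ? λ g → all? λ u →
    ¬? (u ≟ 𝟎) →-dec (S ∋? comb g u) ×-dec ¬? (comb g u ≟ 𝟎) ×-dec (E (comb g u) Bool.≟ false)

  clique-⊆ : {A B : Sub n} → A ⊆ B → HasClique A k → HasClique B k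
  clique-⊆ A⊆B (g , g-clique) = g , λ u u≢𝟎 → let a , b = g-clique u u≢𝟎 in A⊆B a , b

  singleClique : {S : Sub n} {v : V n} → S ∋ v → v ≢ 𝟎 → E v ≡ false → HasClique S 1
  singleClique {S} {v} v∈ v≢𝟎 Ev = v ∷ [] , λ
    { (true ∷ [])  _ → subst (λ x → S ∋ x × x ≢ 𝟎 × E x ≡ false) (sym (⊕-identityʳ v)) (v∈ , v≢𝟎 , Ev)
    ; (false ∷ []) p → contradiction refl p }

  clique-⊆S : {S : Sub n} {g : Vec (V n) k} → IsClique S g → ∀ u → S ∋ comb g u
  clique-⊆S {S = S} {g} cl u with u ≟ 𝟎
  ... | yes refl = subst (S ∋_) (sym (comb-𝟎 g)) (∋-𝟎 S)
  ... | no u≢𝟎  = proj₁ (cl u u≢𝟎)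

  clique-indep : {S : Sub n} {g : Vec (V n) k} → IsClique S g → Independent g
  clique-indep cl u p = decidable-stable (u ≟ 𝟎) (λ u≢𝟎 → proj₁ (proj₂ (cl u u≢𝟎)) p)

  clique-∉ : {S : Sub n} {g : Vec (V n) k} → E 𝟎 ≡ false → IsClique S g → ∀ u → E (comb g u) ≡ false
  clique-∉ {g = g} E𝟎 cl u with u ≟ 𝟎
  ... | yes refl = trans (cong E (comb-𝟎 g)) E𝟎
  ... | no u≢𝟎  = proj₂ (proj₂ (cl u u≢𝟎))

  -- Towers: the intrinsic form of iterated lift-joins.  A level A ⊆ B says that
  -- E restricted to B is a lift-join of E restricted to A with a matroid on
  -- B / A whose complement is triangle-free.

  record Level (A B : Sub n) : Set where
    field
      invariant    : ∀ {v a} → B ∋ v → ¬ A ∋ v → A ∋ a → E (v ⊕ a) ≡ E v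
      triangleFree : ∀ {x y} → B ∋ x → B ∋ y → ¬ A ∋ x → ¬ A ∋ y → ¬ A ∋ x ⊕ y →
                     E x ≡ false → E y ≡ false → E (x ⊕ y) ≢ false
  open Level

  data Tower : ℕ → Sub n → Set₁ where
    base : ∀ {F} → (∀ {v} → F ∋ v → v ≡ 𝟎) → Tower 0 F
    step : ∀ {t A F} → A ⊆ F → Tower t A → Level A F → Tower (suc t) F

  level-refl : (F : Sub n) → Level F F
  level-refl F = record
    { invariant    = λ v∈ v∉ → contradiction v∈ v∉
    ; triangleFree = λ x∈ _ x∉ → contradiction x∈ x∉ }

  tower-pad : ∀ k {F} → Tower t F → Tower (k + t) F
  tower-pad zero    T = T
  tower-pad (suc k) {F} T = step {A = F} id (tower-pad k T) (level-refl F)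

  -- Vectors of `E` create no triangle in the complement, so the last level absorbs them without a
  -- new level.
  tower-top : ∀ {F} G → F ⊆ G → (∀ {v} → G ∋ v → ¬ F ∋ v → E v ≡ true) → Tower (suc t) F → Tower (suc t) G
  tower-top {F = F} G F⊆G full (step {A = A} A⊆F T lvl) = step (F⊆G ∘ A⊆F) T (record
    { invariant = inv ; triangleFree = tri })
    where
    inv : ∀ {v a} → G ∋ v → ¬ A ∋ v → A ∋ a → E (v ⊕ a) ≡ E v
    inv {v} {a} v∈ v∉ a∈ with F ∋? v
    ... | yes v∈F = invariant lvl v∈F v∉ a∈
    ... | no v∉F  = trans (full (∋-⊕ G v∈ (F⊆G (A⊆F a∈))) (v∉F ∘ ∋-cancelʳ F (A⊆F a∈))) (sym (full v∈ v∉F))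
    E-false : ∀ {v} → G ∋ v → E v ≡ false → F ∋ v
    E-false {v} v∈ Ev = decidable-stable (F ∋? v) (λ v∉F → true≢false (full v∈ v∉F) Ev)
    tri : ∀ {x y} → G ∋ x → G ∋ y → ¬ A ∋ x → ¬ A ∋ y → ¬ A ∋ x ⊕ y → E x ≡ false → E y ≡ false → E (x ⊕ y) ≢ false
    tri x∈ y∈ x∉ y∉ xy∉ Ex Ey = triangleFree lvl (E-false x∈ Ex) (E-false y∈ Ey) x∉ y∉ xy∉ Ex Ey

  tower-resp : {F G : Sub n} → F ⊆ G → G ⊆ F → Tower t F → Tower t G
  tower-resp F⊆G G⊆F (base triv) = base (triv ∘ G⊆F)
  tower-resp F⊆G G⊆F (step A⊆F T lvl) = step (F⊆G ∘ A⊆F) T (record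
    { invariant    = invariant lvl ∘ G⊆F
    ; triangleFree = λ x∈ y∈ → triangleFree lvl (G⊆F x∈) (G⊆F y∈) })

  -- Associativity of the lift-join in intrinsic form: since the nonzero `C`-part alone decides
  -- membership in `E`, each level `C′ ⊆ C` becomes a level `A ⊞ C′ ⊆ A ⊞ C` on top of the tower of
  -- `A`.
  tower-append : {A C : Sub n} → (∀ {a c} → A ∋ a → C ∋ c → c ≢ 𝟎 → E (a ⊕ c) ≡ E c) →
                 Tower s A → Tower t C → Tower (t + s) (A ⊞ C)
  tower-append {A = A} {C} dec TA (base triv) = tower-resp (⊞-inˡ A C)
    (⊞-⊆ A C A id (λ c∈ → subst (A ∋_) (sym (triv c∈)) (∋-𝟎 A))) TA
  tower-append {A = A} {C} dec TA (step {A = C′} C′⊆C TC lvl) =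
    step {A = A ⊞ C′} (⊞-⊆ A C′ (A ⊞ C) (⊞-inˡ A C) (⊞-inʳ A C ∘ C′⊆C))
      (tower-append (λ a∈ c∈ → dec a∈ (C′⊆C c∈)) TA TC) (record { invariant = inv ; triangleFree = tri })
    where
    outside : ∀ {a c} → A ∋ a → ¬ A ⊞ C′ ∋ a ⊕ c → ¬ C′ ∋ c
    outside {a} {c} a∈ v∉ c∈ = v∉ (a , c , a∈ , c∈ , refl)
    ≢𝟎 : ∀ {c} → ¬ C′ ∋ c → c ≢ 𝟎
    ≢𝟎 c∉ refl = c∉ (∋-𝟎 C′)
    inv : ∀ {v d} → A ⊞ C ∋ v → ¬ A ⊞ C′ ∋ v → A ⊞ C′ ∋ d → E (v ⊕ d) ≡ E v
    inv (a , c , a∈ , c∈ , refl) v∉ (a′ , c′ , a′∈ , c′∈ , refl) = begin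
      E ((a ⊕ c) ⊕ (a′ ⊕ c′)) ≡⟨ cong E (⊕-interchange a c a′ c′) ⟩
      E ((a ⊕ a′) ⊕ (c ⊕ c′)) ≡⟨ dec (∋-⊕ A a∈ a′∈) (∋-⊕ C c∈ (C′⊆C c′∈)) (≢𝟎 (c∉ ∘ ∋-cancelʳ C′ c′∈)) ⟩
      E (c ⊕ c′)              ≡⟨ invariant lvl c∈ c∉ c′∈ ⟩
      E c                     ≡⟨ dec a∈ c∈ (≢𝟎 c∉) ⟨
      E (a ⊕ c)               ∎
      where
      open ≡-Reasoning
      c∉ : ¬ C′ ∋ c
      c∉ = outside a∈ v∉
    tri : ∀ {x y} → A ⊞ C ∋ x → A ⊞ C ∋ y → ¬ A ⊞ C′ ∋ x → ¬ A ⊞ C′ ∋ y → ¬ A ⊞ C′ ∋ x ⊕ y →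
          E x ≡ false → E y ≡ false → E (x ⊕ y) ≢ false
    tri (a , c , a∈ , c∈ , refl) (b , d , b∈ , d∈ , refl) x∉ y∉ xy∉ Ex Ey Exy =
      triangleFree lvl c∈ d∈ c∉ d∉ cd∉ (trans (sym (dec a∈ c∈ (≢𝟎 c∉))) Ex) (trans (sym (dec b∈ d∈ (≢𝟎 d∉))) Ey)
        (trans (sym (dec (∋-⊕ A a∈ b∈) (∋-⊕ C c∈ d∈) (≢𝟎 cd∉))) (trans (sym (cong E (⊕-interchange a c b d))) Exy))
      where
      c∉ : ¬ C′ ∋ c
      c∉ = outside a∈ x∉
      d∉ : ¬ C′ ∋ d
      d∉ = outside b∈ y∉
      cd∉ : ¬ C′ ∋ c ⊕ d
      cd∉ = outside (∋-⊕ A a∈ b∈) (xy∉ ∘ subst (A ⊞ C′ ∋_) (sym (⊕-interchange a c b d)))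

  -- The same chain read from below: a `Tower` exposes its top level, whereas `iterLiftJoin`
  -- consumes its factors from the bottom.
  data Ascent : ℕ → Sub n → Sub n → Set₁ where
    done : ∀ {A B} → A ⊆ B → B ⊆ A → Ascent 0 A B
    step : ∀ {A B C} → A ⊆ B → Level A B → Ascent t B C → Ascent (suc t) A C

  ascend : ∀ {F G} → Tower t F → Ascent k F G → Σ (Sub n) λ Z → (∀ {v} → Z ∋ v → v ≡ 𝟎) × Ascent (t + k) Z G
  ascend (base triv) up = _ , triv , up
  ascend {k = k} {G = G} (step {t = t} A⊆F T lvl) up with Z , triv , up′ ← ascend T (step A⊆F lvl up) =
    Z , triv , subst (λ j → Ascent j Z G) (ℕ.+-suc t k) up′

-- From towers of subspaces to iterated lift-joins

isZero-true : (v : V n) → isZero v ≡ true → v ≡ 𝟎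
isZero-true []          _ = refl
isZero-true (false ∷ v) p = cong (false ∷_) (isZero-true v p)

complement-intro : (M : Matroid n) {v : V n} → v ≢ 𝟎 → E M v ≡ false → E (complement M) v ≡ true
complement-intro M {v} v≢𝟎 Ev with isZero v in eq
... | true  = contradiction (isZero-true v eq) v≢𝟎
... | false = cong not Ev

complement-elim : (M : Matroid n) {v : V n} → E (complement M) v ≡ true → E M v ≡ false
complement-elim M {v} p with isZero v
... | false = Bool.not-injective p

α≤⇒¬clique : (M : Matroid n) → α≤ M s → ¬ HasClique (E M) ⊤ˢ (suc s)
α≤⇒¬clique M α (g , g-clique) = ℕ.1+n≰n (α _ record
  { emb = comb g ; emb-lin = comb-⊕ g ; emb-inj = injective-from-kernel (comb-⊕ g) (clique-indep (E M) {S = ⊤ˢ} {g = g} g-clique) }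
  (λ x x≢𝟎 → let _ , p , q = g-clique x x≢𝟎 in complement-intro M p q))

trivialMatroid : Matroid 0
trivialMatroid = record { E = λ _ → false ; E-𝟎 = refl }

module _ (M : Matroid n) where

  record Chart (A : Sub n) (N : AnyMatroid) : Set where
    field
      vectors : Vec (V n) (proj₁ N)
      indep   : Independent vectors
      inside  : ∀ u → A ∋ comb vectors u
      onto    : ∀ {v} → A ∋ v → ∃ λ u → comb vectors u ≡ v
      agrees  : ∀ u → E M (comb vectors u) ≡ E (proj₂ N) u

  -- The new factor lives on the vectors completing the chart of `A` to a basis of `B`. Outside `A`,
  -- `invariant` erases the `A`-part of a vector, which is the second branch of `⊗`.
  extendChart : {A B : Sub n} {N : AnyMatroid} → A ⊆ B → Level (E M) A B → Chart A N →
                Σ AnyMatroid λ N′ → TriangleFree (complement (proj₂ N′)) × Chart B (N ⊗' N′)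
  extendChart {A} {B} {a , N} A⊆B lvl chart = (X.dim , N′) , triFree , record
    { vectors = g ++ h
    ; indep   = λ v p → let q , r = X.indep (fstV a v) (sndV a v) (trans (sym (comb-++ g h v)) p) in fstV-sndV-𝟎 a v q r
    ; inside  = λ v → subst (B ∋_) (sym (comb-++ g h v)) (∋-⊕ B (A⊆B (inside _)) (X.inside _))
    ; onto    = λ v∈ → let x , y , p = X.spans v∈ in x ++ y , trans (comb-++′ g h x y) p
    ; agrees  = λ v → trans (cong (E M) (comb-++ g h v)) (agree (fstV a v) (sndV a v))
    }
    where
    open Chart chart renaming (vectors to g)
    module X = Extension (extend B g indep (λ u → A⊆B (inside u)))
    open Level
    h : Vec (V n) X.dim
    h = X.vectors
    N′ : Matroid X.dim
    N′ = record { E = λ y → E M (comb h y) ; E-𝟎 = trans (cong (E M) (comb-𝟎 h)) (E-𝟎 M) }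
    outside : ∀ {y} → y ≢ 𝟎 → ¬ A ∋ comb h y
    outside {y} y≢𝟎 y∈ with x , p ← onto y∈ =
      y≢𝟎 (proj₂ (X.indep x y (trans (cong (_⊕ comb h y) p) (⊕-self _))))
    agree : ∀ x y → E M (comb g x ⊕ comb h y) ≡ (if isZero y then E N x else E N′ y)
    agree x y with isZero y in eq
    ... | true with refl ← isZero-true y eq =
      trans (cong (E M) (trans (cong (comb g x ⊕_) (comb-𝟎 h)) (⊕-identityʳ _))) (agrees x)
    ... | false = trans (cong (E M) (⊕-comm _ _)) (invariant lvl (X.inside y) (outside y≢𝟎) (inside x))
      where
      y≢𝟎 : y ≢ 𝟎
      y≢𝟎 refl with () ← trans (sym (isZero-𝟎 X.dim)) eq
    triFree : TriangleFree (complement N′)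
    triFree ψ flat = triangleFree lvl (X.inside p) (X.inside q) (out e₁) (out e₂)
      (subst (λ v → ¬ A ∋ v) pq (out e₃)) (val e₁) (val e₂) (trans (cong (E M) (sym pq)) (val e₃))
      where
      e₁ : Σ (V 2) (_≢ 𝟎)
      e₁ = true ∷ false ∷ [] , λ ()
      e₂ : Σ (V 2) (_≢ 𝟎)
      e₂ = false ∷ true ∷ [] , λ ()
      e₃ : Σ (V 2) (_≢ 𝟎)
      e₃ = true ∷ true ∷ [] , λ ()
      p q : V X.dim
      p = emb ψ (proj₁ e₁)
      q = emb ψ (proj₁ e₂)
      pq : comb h (emb ψ (proj₁ e₃)) ≡ comb h p ⊕ comb h q
      pq = trans (cong (comb h) (emb-lin ψ (proj₁ e₁) (proj₁ e₂))) (comb-⊕ h p q)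
      out : (e : Σ (V 2) (_≢ 𝟎)) → ¬ A ∋ comb h (emb ψ (proj₁ e))
      out (e , e≢𝟎) = outside (λ z → e≢𝟎 (emb-inj ψ e 𝟎 (trans z (sym (emb-𝟎 ψ)))))
      val : (e : Σ (V 2) (_≢ 𝟎)) → E M (comb h (emb ψ (proj₁ e))) ≡ false
      val (e , e≢𝟎) = complement-elim N′ (flat e e≢𝟎)

  chartAscent : {A B : Sub n} {N : AnyMatroid} → Ascent (E M) t A B → Chart A N →
                Σ (Vec AnyMatroid t) λ Ns → (∀ i → TriangleFree (complement (proj₂ (lookup Ns i)))) ×
                Chart B (iterLiftJoin (N ∷ Ns))
  chartAscent (done A⊆B B⊆A) chart = [] , (λ ()) , record
    { vectors = vectors ; indep = indep ; inside = A⊆B ∘ inside ; onto = onto ∘ B⊆A ; agrees = agrees }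
    where open Chart chart
  chartAscent (step A⊆B lvl up) chart
    with N′ , tf , chart′ ← extendChart A⊆B lvl chart
    with Ns , tfs , chart″ ← chartAscent up chart′ =
    N′ ∷ Ns , (λ { zero → tf ; (suc i) → tfs i }) , chart″

  trivialChart : {Z : Sub n} → (∀ {v} → Z ∋ v → v ≡ 𝟎) → Chart Z (0 , trivialMatroid)
  trivialChart {Z} triv = record
    { vectors = [] ; indep = []-independent ; inside = []-⊆ Z
    ; onto = λ v∈ → [] , sym (triv v∈) ; agrees = λ { [] → E-𝟎 M } }

  trivialTriangleFree : TriangleFree (complement trivialMatroid)
  trivialTriangleFree ψ flat with emb-inj ψ (true ∷ true ∷ []) 𝟎 (V0-unique _ _)
    where
    V0-unique : (x y : V 0) → x ≡ y
    V0-unique [] [] = refl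
  ... | ()

  -- The zero space at the bottom of the tower supplies a first factor of dimension `0`, so `t`
  -- levels give `suc t` factors.
  towerToLiftJoin : {F : Sub n} → Tower (E M) t F → Codim≤ k F ⊤ˢ →
    Σ (Vec AnyMatroid (suc t)) λ Ms →
      (∀ i → TriangleFree (complement (proj₂ (lookup Ms i)))) ×
      Σ (Flat (proj₁ (iterLiftJoin Ms)) n) λ ψ →
        (n ∸ proj₁ (iterLiftJoin Ms) ≤ k) × Iso (restrict M ψ) (proj₂ (iterLiftJoin Ms))
  towerToLiftJoin {t} {k} {F} T (h , h-cov) = (0 , trivialMatroid) ∷ Ns , allTriangleFree ,
    record { emb = comb g ; emb-lin = comb-⊕ g ; emb-inj = injective-from-kernel (comb-⊕ g) C.indep } ,
    -- The chart and the `k` vectors of the codimension bound together span the ambient space.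
    ℕ.m≤n+o⇒m∸n≤o _ _ (surjective⇒≤ (comb (g ++ h)) surj) ,
    record { to = id ; from = id ; to-lin = λ _ _ → refl ; from-to = λ _ → refl ; to-from = λ _ → refl
           ; preserves = λ x → sym (C.agrees x) }
    where
    ascent : Σ (Sub n) λ Z → (∀ {v} → Z ∋ v → v ≡ 𝟎) × Ascent (E M) t Z F
    ascent = subst (λ j → Σ (Sub n) λ Z → (∀ {v} → Z ∋ v → v ≡ 𝟎) × Ascent (E M) j Z F) (ℕ.+-identityʳ t)
      (ascend (E M) T (done id id))
    charted : Σ (Vec AnyMatroid t) λ Ns → (∀ i → TriangleFree (complement (proj₂ (lookup Ns i)))) ×
              Chart F (iterLiftJoin ((0 , trivialMatroid) ∷ Ns))
    charted = chartAscent (proj₂ (proj₂ ascent)) (trivialChart {Z = proj₁ ascent} (proj₁ (proj₂ ascent)))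
    Ns : Vec AnyMatroid t
    Ns = proj₁ charted
    module C = Chart (proj₂ (proj₂ charted))
    g : Vec (V n) (proj₁ (iterLiftJoin ((0 , trivialMatroid) ∷ Ns)))
    g = C.vectors
    allTriangleFree : ∀ i → TriangleFree (complement (proj₂ (lookup ((0 , trivialMatroid) ∷ Ns) i)))
    allTriangleFree zero    = trivialTriangleFree
    allTriangleFree (suc i) = proj₁ (proj₂ charted) i
    surj : ∀ v → ∃ λ u → comb (g ++ h) u ≡ v
    surj v with y , p ← h-cov {v} refl with x , q ← C.onto p =
      x ++ y , trans (comb-++′ g h x y) (trans (cong (_⊕ comb h y) q) (⊕-cancelʳ v (comb h y)))

-- Families of subspaces of F₂ˢ

Tri : V n → V n → V n → Set
Tri x y z = x ⊕ y ⊕ z ≡ 𝟎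

tri : (x y : V n) → Tri x y (x ⊕ y)
tri x y = ⊕-self (x ⊕ y)

yxz : {x y z : V n} → Tri x y z → Tri y x z
yxz {x = x} {y} {z} p = trans (cong (_⊕ z) (⊕-comm y x)) p

yzx : {x y z : V n} → Tri x y z → Tri y z x
yzx {x = x} {y} {z} p = trans (solve (x ∷ y ∷ z ∷ []) (v₁ :⊕ v₂ :⊕ v₀) (v₀ :⊕ v₁ :⊕ v₂) refl) p

zxy : {x y z : V n} → Tri x y z → Tri z x y
zxy {x = x} {y} {z} p = trans (solve (x ∷ y ∷ z ∷ []) (v₂ :⊕ v₀ :⊕ v₁) (v₀ :⊕ v₁ :⊕ v₂) refl) p

xzy : {x y z : V n} → Tri x y z → Tri x z y
xzy {x = x} {y} {z} p = trans (solve (x ∷ y ∷ z ∷ []) (v₀ :⊕ v₂ :⊕ v₁) (v₀ :⊕ v₁ :⊕ v₂) refl) p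

_⊆?_ : (A B : Sub n) → Dec (A ⊆ B)
A ⊆? B = map′ (λ f {v} → f v) (λ f v → f {v}) (all? (λ v → (A ∋? v) →-dec (B ∋? v)))

⊈⇒∃ : (A B : Sub n) → ¬ A ⊆ B → ∃ λ v → A ∋ v × ¬ B ∋ v
⊈⇒∃ A B A⊈B = decidable-stable (any? (λ v → (A ∋? v) ×-dec ¬? (B ∋? v)))
  (λ ∄v → A⊈B (λ {v} v∈ → decidable-stable (B ∋? v) (λ v∉ → ∄v (v , v∈ , v∉))))

-- Exchanging `y` and `z` gives the reverse inclusion, so `L y` and `L z` agree modulo `λ′`.
PivotRule : (V m → Sub s) → Set
PivotRule L = ∀ {x y z λ′ μ} → Tri x y z → L x ∋ λ′ → ¬ (L y ∋ λ′ × L z ∋ λ′) → L y ∋ μ → L z ∋ μ ⊎ L z ∋ μ ⊕ λ′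

module Pivot (L : V m → Sub s) (pivot : PivotRule L) where

  -- Since `λ′` is missing from `L z`, the pivot rule can be used from both `x` and `y`. The outcome
  -- is rigid: `L x = L y`, and `L z` has index two in it.
  two-of-three : ∀ {x y z λ′} → Tri x y z → L x ∋ λ′ → L y ∋ λ′ → ¬ L z ∋ λ′ →
    L z ⊆ L x × L x ⊆ L y × (∀ {μ} → L x ∋ μ → L z ∋ μ ⊎ L z ∋ μ ⊕ λ′)
  two-of-three {x} {y} {z} {λ′} xyz x∋ y∋ z∌ = z⊆x , x⊆y , x⊆z+λ
    where
    z⊆x : L z ⊆ L x
    z⊆x μ∈ = [ id , ∋-cancelʳ (L x) x∋ ]′ (pivot (yzx xyz) y∋ (z∌ ∘ proj₁) μ∈)
    z⊆y : L z ⊆ L y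
    z⊆y μ∈ = [ id , ∋-cancelʳ (L y) y∋ ]′ (pivot (xzy xyz) x∋ (z∌ ∘ proj₁) μ∈)
    x⊆z+λ : ∀ {μ} → L x ∋ μ → L z ∋ μ ⊎ L z ∋ μ ⊕ λ′
    x⊆z+λ = pivot (yxz xyz) y∋ (z∌ ∘ proj₂)
    x⊆y : L x ⊆ L y
    x⊆y μ∈ = [ z⊆y , ∋-cancelʳ (L y) y∋ ∘ z⊆y ]′ (x⊆z+λ μ∈)

  ∣_∣ : V m → ℕ
  ∣ x ∣ = count (λ v → L x ∋? v)

  ⊆⇒≤ : ∀ {x y} → L x ⊆ L y → ∣ x ∣ ≤ ∣ y ∣
  ⊆⇒≤ {x} {y} x⊆y = count-mono (L x ∋?_) (L y ∋?_) (λ _ → x⊆y)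

  ⊆∧≥⇒⊇ : ∀ {x y} → L x ⊆ L y → ∣ y ∣ ≤ ∣ x ∣ → L y ⊆ L x
  ⊆∧≥⇒⊇ {x} {y} x⊆y y≤x {μ} μ∈ = decidable-stable (L x ∋? μ)
    (λ μ∉ → ℕ.≤⇒≯ y≤x (count-strict (L x ∋?_) (L y ∋?_) (λ _ → x⊆y) μ μ∉ μ∈))

  ≤-by-coset : ∀ {x y λ′} → ¬ L x ∋ λ′ → (∀ {μ} → L x ∋ μ → L y ∋ μ ⊎ L y ∋ μ ⊕ λ′) → ∣ x ∣ ≤ ∣ y ∣
  ≤-by-coset {x} {y} {λ′} λ∉ cover = count-coset (L x ∋?_) (L y ∋?_) λ′ (λ _ μ∈ → λ∉ ∘ ∋-cancelˡ (L x) μ∈) (λ _ → cover)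

  -- Take a functional in `L x` but not in `L y`. If it lies in `L t`, then `L t ⊆ L x`; if not,
  -- adding it where necessary injects `L t` into `L y`. Either way `t` is not the strict maximum.
  smaller-equal : ∀ {x y t} → Tri x y t → ∣ x ∣ < ∣ t ∣ → ∣ y ∣ < ∣ t ∣ → L x ⊆ L y
  smaller-equal {x} {y} {t} xyt x<t y<t {μ} μ∈ = decidable-stable (L y ∋? μ) absurd
    where
    absurd : ¬ ¬ L y ∋ μ
    absurd μ∉y with L t ∋? μ
    ... | yes μ∈t = ℕ.<⇒≱ x<t (⊆⇒≤ (proj₁ (proj₂ (two-of-three (zxy xyt) μ∈t μ∈ μ∉y))))
    ... | no μ∉t  = ℕ.<⇒≱ y<t (≤-by-coset μ∉t (pivot (xzy xyt) μ∈ (μ∉y ∘ proj₂)))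

  smaller-below : ∀ {x y t} → Tri x y t → ∣ x ∣ < ∣ t ∣ → ∣ y ∣ < ∣ t ∣ → L x ⊆ L t
  smaller-below {x} {y} {t} xyt x<t y<t {μ} μ∈ = decidable-stable (L t ∋? μ)
    (λ μ∉ → ℕ.<⇒≱ x<t (⊆⇒≤ (proj₁ (two-of-three xyt μ∈ (smaller-equal xyt x<t y<t μ∈) μ∉))))

  -- Stabilisers.  On S any three summing vectors carry distinct hyperplanes of
  -- a common space (or points over a common space), so the third member of a
  -- triple is determined by the other two; hence vectors with equal L differ by
  -- an element of the stabiliser, which therefore has bounded index.
  module Stabiliser
    {S : V m → Set} (S? : ∀ c → Dec (S c))
    (sum-closed : ∀ {a b} → S a → S b → ¬ L a ⊆ L b → S (a ⊕ b))
    (incomparable : ∀ {a b} → S a → S b → L a ⊆ L b → L b ⊆ L a)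
    {c₁ c₂ : V m} (S-c₁ : S c₁) (S-c₂ : S c₂) (c₁⊈c₂ : ¬ L c₁ ⊆ L c₂)
    where

    Same : V m → V m → Set
    Same a b = L a ⊆ L b × L b ⊆ L a

    -- A functional missing from `z` alone would make `L z` properly smaller than `L x`, which
    -- `incomparable` excludes.
    all-three : ∀ {x y z μ} → Tri x y z → S x → S z → L x ∋ μ → L y ∋ μ → L z ∋ μ
    all-three {z = z} {μ} xyz Sx Sz x∋ y∋ = decidable-stable (L z ∋? μ)
      (λ z∌ → z∌ (incomparable Sz Sx (proj₁ (two-of-three xyz x∋ y∋ z∌)) x∋))

    ⊈-sym : ∀ {a b} → S a → S b → ¬ L a ⊆ L b → ¬ L b ⊆ L a
    ⊈-sym Sa Sb a⊈b b⊆a = a⊈b (incomparable Sb Sa b⊆a)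

    ⊈-sum : ∀ {a b} → S a → S b → ¬ L a ⊆ L b → ¬ L a ⊆ L (a ⊕ b)
    ⊈-sum {a} {b} Sa Sb a⊈b a⊆ab with μ , a∋ , b∌ ← ⊈⇒∃ (L a) (L b) a⊈b =
      b∌ (all-three (xzy (tri a b)) Sa Sb a∋ (a⊆ab a∋))

    -- By `all-three`, the part of `L (a ⊕ b)` inside `L a` is `L a ∩ L b`. For a fixed `μ` in `L b`
    -- outside `L a`, any other `ν` in it has `ν ⊕ μ` in `L a` but not in `L b`. Both descriptions
    -- refer to `L a` and `L b` only.
    sum-determined : ∀ {a b a′ b′} → S a → S b → S a′ → S b′ → Same a a′ → Same b b′ → ¬ L a ⊆ L b →
                     L (a ⊕ b) ⊆ L (a′ ⊕ b′)
    sum-determined {a} {b} {a′} {b′} Sa Sb Sa′ Sb′ (a⊆a′ , a′⊆a) (b⊆b′ , b′⊆b) a⊈b {ν} ν∈ with L a ∋? ν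
    ... | yes a∋ν = all-three (tri a′ b′) Sa′ Sa′b′ (a⊆a′ a∋ν)
      (b⊆b′ (all-three (xzy (tri a b)) Sa Sb a∋ν ν∈))
      where
      Sa′b′ : S (a′ ⊕ b′)
      Sa′b′ = sum-closed Sa′ Sb′ (λ p → a⊈b (b′⊆b ∘ p ∘ a⊆a′))
    ... | no a∌ν with μ , b∋μ , a∌μ ← ⊈⇒∃ (L b) (L a) (⊈-sym Sa Sb a⊈b) =
      [ (λ a∋ν → contradiction a∋ν a∌ν) , from-a ]′ (pivot (yzx (tri a b)) b∋μ (a∌μ ∘ proj₂) ν∈)
      where
      b∌ν : ¬ L b ∋ ν
      b∌ν b∋ν = a∌ν (all-three (yzx (tri a b)) Sb Sa b∋ν ν∈)
      from-a : L a ∋ ν ⊕ μ → L (a′ ⊕ b′) ∋ ν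
      from-a a∋νμ = [ (λ q → contradiction (b′⊆b (all-three (xzy (tri a′ b′)) Sa′ Sb′ (a⊆a′ a∋νμ) q)) (λ r → b∌ν (∋-cancelʳ (L b) b∋μ r)))
                    , subst (L (a′ ⊕ b′) ∋_) (⊕-cancelʳ ν μ) ]′
        (pivot (yxz (tri a′ b′)) (b⊆b′ b∋μ) (a∌μ ∘ a′⊆a ∘ proj₁) (a⊆a′ a∋νμ))

    same-sym : ∀ {a b} → Same a b → Same b a
    same-sym (p , q) = q , p

    sum-same : ∀ {a b a′ b′} → S a → S b → S a′ → S b′ → Same a a′ → Same b b′ → ¬ L a ⊆ L b →
               Same (a ⊕ b) (a′ ⊕ b′)
    sum-same Sa Sb Sa′ Sb′ aa′ bb′ a⊈b = sum-determined Sa Sb Sa′ Sb′ aa′ bb′ a⊈b ,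
      sum-determined Sa′ Sb′ Sa Sb (same-sym aa′) (same-sym bb′) (λ p → a⊈b (proj₂ bb′ ∘ p ∘ proj₁ aa′))

    Fixes : V m → Set
    Fixes r = ∀ c → S c → S (c ⊕ r) × Same (c ⊕ r) c

    same? : ∀ a b → Dec (Same a b)
    same? a b = (L a ⊆? L b) ×-dec (L b ⊆? L a)

    resp : ∀ {a b c} → a ≡ b → S a × Same a c → S b × Same b c
    resp refl p = p

    stabiliser : Sub m
    stabiliser = record
      { _∋_  = Fixes
      ; _∋?_ = λ r → all? (λ c → S? c →-dec S? (c ⊕ r) ×-dec same? (c ⊕ r) c)
      ; ∋-𝟎  = λ c Sc → resp (sym (⊕-identityʳ c)) (Sc , id , id)
      ; ∋-⊕  = λ {r} {r′} fix fix′ c Sc →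
          let Scr , p , q = fix c Sc
              Scrr′ , p′ , q′ = fix′ (c ⊕ r) Scr
          in resp (⊕-assoc c r r′) (Scrr′ , p ∘ p′ , q′ ∘ q)
      }

    different : ∀ {e} → S e → ∃ λ f → S f × ¬ L f ⊆ L e
    different {e} Se with L c₁ ⊆? L e
    ... | no c₁⊈e  = c₁ , S-c₁ , c₁⊈e
    ... | yes c₁⊆e = c₂ , S-c₂ , λ c₂⊆e → c₁⊈c₂ (incomparable S-c₂ Se c₂⊆e ∘ c₁⊆e)

    ⊈-sum-class : ∀ {c c′ e} → S c → Same c c′ → S e → ¬ L e ⊆ L c → ¬ L (e ⊕ c) ⊆ L c′
    ⊈-sum-class {c} {c′} {e} Sc (_ , c′⊆c) Se e⊈c p = ⊈-sum Sc Se (⊈-sym Se Sc e⊈c)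
      (subst (λ z → L c ⊆ L z) (⊕-comm e c) (incomparable (sum-closed Se Sc e⊈c) Sc (c′⊆c ∘ p)))

    fixes-different : ∀ {c c′ e} → S c → S c′ → Same c c′ → S e → ¬ L e ⊆ L c →
                      S (e ⊕ (c ⊕ c′)) × Same (e ⊕ (c ⊕ c′)) e
    fixes-different {c} {c′} {e} Sc Sc′ cc′ Se e⊈c = resp (⊕-assoc e c c′) (sum-closed Sec Sc′ ec⊈c′ ,
      subst (Same ((e ⊕ c) ⊕ c′)) (⊕-cancelʳ e c) (sum-same Sec Sc′ Sec Sc (id , id) (same-sym cc′) ec⊈c′))
      where
      Sec : S (e ⊕ c)
      Sec = sum-closed Se Sc e⊈c
      ec⊈c′ : ¬ L (e ⊕ c) ⊆ L c′
      ec⊈c′ = ⊈-sum-class Sc cc′ Se e⊈c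

    -- If the space of `e` differs from that of `c`, adding first `c` and then `c′` stays within
    -- `sum-same`. If it does not, `e` is replaced by `e ⊕ f` with `f` in another class, and `f` is
    -- added back afterwards.
    same⇒fixes : ∀ {c c′} → S c → S c′ → Same c c′ → Fixes (c ⊕ c′)
    same⇒fixes {c} {c′} Sc Sc′ cc′ e Se with L e ⊆? L c
    ... | no e⊈c  = fixes-different Sc Sc′ cc′ Se e⊈c
    ... | yes e⊆c = resp rearrange (sum-closed Sefr Sf efr⊈f ,
      subst (Same (((e ⊕ f) ⊕ r) ⊕ f)) (⊕-cancelʳ e f) (sum-same Sefr Sf Sef Sf efr-same (id , id) efr⊈f))
      where
      r f : V m
      r = c ⊕ c′
      f = proj₁ (different Se)
      Sf : S f
      Sf = proj₁ (proj₂ (different Se))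
      f⊈e : ¬ L f ⊆ L e
      f⊈e = proj₂ (proj₂ (different Se))
      Sef : S (e ⊕ f)
      Sef = sum-closed Se Sf (⊈-sym Sf Se f⊈e)
      ef⊈c : ¬ L (e ⊕ f) ⊆ L c
      ef⊈c p = ⊈-sum Se Sf (⊈-sym Sf Se f⊈e) (incomparable Sef Se (incomparable Se Sc e⊆c ∘ p))
      Sefr : S ((e ⊕ f) ⊕ r)
      Sefr = proj₁ (fixes-different Sc Sc′ cc′ Sef ef⊈c)
      efr-same : Same ((e ⊕ f) ⊕ r) (e ⊕ f)
      efr-same = proj₂ (fixes-different Sc Sc′ cc′ Sef ef⊈c)
      efr⊈f : ¬ L ((e ⊕ f) ⊕ r) ⊆ L f
      efr⊈f p = ⊈-sum Sf Se f⊈e (subst (λ z → L f ⊆ L z) (⊕-comm e f) (incomparable Sef Sf (p ∘ proj₂ efr-same)))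
      rearrange : ((e ⊕ f) ⊕ r) ⊕ f ≡ e ⊕ r
      rearrange = solve (e ∷ f ∷ r ∷ []) (((v₀ :⊕ v₁) :⊕ v₂) :⊕ v₁) (v₀ :⊕ v₂) refl

    -- The membership table of `L c`. There are `2 ^ (2 ^ s)` possible tables, whence the index
    -- bound.
    colour : V m → V (size s)
    colour c = map (λ μ → does (L c ∋? μ)) (allV s)

    colour-⊆ : ∀ {c c′} → colour c ≡ colour c′ → L c ⊆ L c′
    colour-⊆ {c} {c′} p {μ} c∋ = does⇒ (L c′ ∋? μ) (trans
      (sym (map-≡⇒ (λ μ → does (L c ∋? μ)) (λ μ → does (L c′ ∋? μ)) p (∈-allV μ))) (dec-true (L c ∋? μ) c∋))

    representative : V (size s) → V m
    representative κ with any? (λ c → S? c ×-dec (colour c ≟ κ))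
    ... | yes (c , _) = c
    -- A colour that does not occur in `S` gets `𝟎`, which keeps all representatives in the span of
    -- `S`.
    ... | no _        = 𝟎

    representative-span : ∀ κ → span S? ∋ representative κ
    representative-span κ with any? (λ c → S? c ×-dec (colour c ≟ κ))
    ... | yes (c , Sc , _) = span-gen S? Sc
    ... | no _             = ∋-𝟎 (span S?)

    representative-fixes : ∀ {c} → S c → Fixes (c ⊕ representative (colour c))
    representative-fixes {c} Sc with any? (λ c′ → S? c′ ×-dec (colour c′ ≟ colour c))
    ... | yes (c′ , Sc′ , eq) = same⇒fixes Sc Sc′ (colour-⊆ (sym eq) , colour-⊆ eq)
    ... | no ∄c′              = contradiction (c , Sc , refl) ∄c′

    representatives : Vec (V m) (size (size s))
    representatives = map representative (allV (size s))

    representatives-span : ∀ u → span S? ∋ comb representatives u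
    representatives-span u = go (allV (size s)) u
      where
      go : ∀ {k} (κs : Vec (V (size s)) k) u → span S? ∋ comb (map representative κs) u
      go []       []          = ∋-𝟎 (span S?)
      go (κ ∷ κs) (true ∷ u)  = ∋-⊕ (span S?) (representative-span κ) (go κs u)
      go (κ ∷ κs) (false ∷ u) = ∋-⊕ (span S?) (∋-𝟎 (span S?)) (go κs u)

    stabiliser-codim : Codim≤ (size (size s)) (stabiliser ∩ˢ span S?) (span S?)
    stabiliser-codim = representatives , λ p∈ → let u , fix = cover p∈ in
      u , fix , ∋-⊕ (span S?) p∈ (representatives-span u)
      where
      cover : ∀ {p} → span S? ∋ p → ∃ λ u → Fixes (p ⊕ comb representatives u)
      cover = span-ind S? (λ p → ∃ λ u → Fixes (p ⊕ comb representatives u))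
        (𝟎 , subst Fixes (sym (trans (⊕-identityˡ _) (comb-𝟎 representatives))) (∋-𝟎 stabiliser))
        (λ {c} {p} Sc (u , fix) →
          let w , eq = comb-∈ (∈-map⁺ representative (∈-allV (colour c)))
          in w ⊕ u , subst Fixes (trans (⊕-interchange c _ p (comb representatives u))
               (cong ((c ⊕ p) ⊕_) (trans (cong (_⊕ comb representatives u) (sym eq)) (sym (comb-⊕ representatives w u)))))
               (∋-⊕ stabiliser (representative-fixes Sc) fix))

    rest : Complement (span S?) ⊤ˢ
    rest = directComplement (span S?) ⊤ˢ (λ _ → refl)

    open Complement rest using () renaming (space to R; disjoint to R-disjoint; covers to R-covers)

    abstract
      -- The index of the stabiliser is bounded only within the span of `S`. Adding a complement `R`
      -- of that span bounds the codimension in the whole space, and vectors of `fixed` inside the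
      -- span still stabilise.
      fixed : Sub m
      fixed = (stabiliser ∩ˢ span S?) ⊞ R

      fixed-codim : Codim≤ (size (size s)) fixed ⊤ˢ
      fixed-codim = codim-mono fixed {⊤ˢ} (ℕ.≤-reflexive (trans (ℕ.+-identityʳ _) (ℕ.+-identityʳ _)))
        (codim-trans fixed {span S? ⊞ R} {⊤ˢ} (codim-⊞ (stabiliser ∩ˢ span S?) R {span S?} {R} stabiliser-codim (codim-⊆ {A = R} {R} id))
          (codim-⊆ {A = span S? ⊞ R} {⊤ˢ} R-covers))

      fixed-fixes : ∀ {f} → fixed ∋ f → span S? ∋ f → Fixes f
      fixed-fixes (r , c , (fix , r∈) , c∈ , refl) f∈ =
        subst Fixes (sym (trans (cong (r ⊕_) (R-disjoint (∋-cancelˡ (span S?) r∈ f∈) c∈)) (⊕-identityʳ r))) fix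

      -- A stabilising `f` preserves `L e`, whereas by `⊈-sum` adding a member of `S` with another
      -- space changes it.
      fixed-avoids : ∀ {f} → fixed ∋ f → ¬ S f
      fixed-avoids {f} f∈ Sf with e , Se , e⊈f ← different Sf =
        ⊈-sum Se Sf e⊈f (proj₂ (proj₂ (fixed-fixes f∈ (span-gen S? Sf) e Se)))

-- The dichotomy for a family satisfying the pivot rule

e₁ e₂ : V (2 + s)
e₁ = true ∷ false ∷ 𝟎
e₂ = false ∷ true ∷ 𝟎

module _ (L : V m → Sub s) where

  -- `missed` will make the decomposer proper, and `free` will put a nonzero vector of the clique
  -- into it.
  record Decomposing : Set₁ where
    field
      T        : Sub m
      missed   : V m
      missed∉  : ¬ T ∋ missed
      L₀       : Sub s
      free     : V s
      free∉    : ¬ L₀ ∋ free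
      above    : ∀ {t} → T ∋ t → L₀ ⊆ L t
      below    : ∀ {c} → ¬ T ∋ c → L c ⊆ L₀
      constant : ∀ {c t} → ¬ T ∋ c → T ∋ t → L c ⊆ L (c ⊕ t) × L (c ⊕ t) ⊆ L c

  -- Over `T` the functional `dir` is constant on every fibre; over the rest of `F` only zero is, so
  -- those fibres are full.
  record Common : Set₁ where
    field
      F T     : Sub m
      codim   : Codim≤ (size (size s)) F ⊤ˢ
      T⊆F     : T ⊆ F
      dir     : V s
      dir≢𝟎   : dir ≢ 𝟎
      shared  : ∀ {t} → T ∋ t → L t ∋ dir
      trivial : ∀ {f} → F ∋ f → ¬ T ∋ f → ∀ {μ} → L f ∋ μ → μ ≡ 𝟎

module Dichotomy (L : V m → Sub (2 + s)) (pivot : PivotRule L) (L-𝟎 : ∀ μ → L 𝟎 ∋ μ) where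
  open Pivot L pivot

  atLeast : ℕ → Sub m
  atLeast k = span (λ t → k ≤? ∣ t ∣)

  ∣∣≤∣𝟎∣ : ∀ t → ∣ t ∣ ≤ ∣ 𝟎 ∣
  ∣∣≤∣𝟎∣ t = ⊆⇒≤ (λ {μ} _ → L-𝟎 μ)

  threshold : ∀ k → ¬ (∀ h → atLeast (suc k) ∋ h) →
              ∃ λ k′ → ¬ (∀ h → atLeast (suc k′) ∋ h) × (∀ h → atLeast k′ ∋ h)
  threshold zero    ¬full = zero , ¬full , λ h → span-gen (λ t → zero ≤? ∣ t ∣) z≤n
  threshold (suc k) ¬full with all? (atLeast (suc k) ∋?_)
  ... | yes full  = suc k , ¬full , full
  ... | no ¬full′ = threshold k ¬full′

  common : ∀ {dir} → dir ≢ 𝟎 → (∀ h → L h ∋ dir) → Common L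
  common {dir} dir≢𝟎 all-dir = record
    { F = ⊤ˢ ; T = ⊤ˢ ; codim = codim-mono ⊤ˢ {⊤ˢ} z≤n (codim-⊆ {A = ⊤ˢ} {⊤ˢ} id) ; T⊆F = id
    ; dir = dir ; dir≢𝟎 = dir≢𝟎 ; shared = λ {t} _ → all-dir t ; trivial = λ _ f∉ → contradiction refl f∉ }

  module AtThreshold (k : ℕ) {h₀ : V m} (h₀∉ : ¬ atLeast (suc k) ∋ h₀) (spans : ∀ h → atLeast k ∋ h) where

    T : Sub m
    T = atLeast (suc k)

    big : ∀ {t} → k < ∣ t ∣ → T ∋ t
    big = span-gen (λ t → suc k ≤? ∣ t ∣)

    small : ∀ {c} → ¬ T ∋ c → ∣ c ∣ ≤ k
    small c∉ = ℕ.≮⇒≥ (c∉ ∘ big)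

    Homogeneous : V m → Set
    Homogeneous t = T ∋ t × (∀ c → ¬ T ∋ c → L c ⊆ L (c ⊕ t) × L (c ⊕ t) ⊆ L c × L c ⊆ L t)

    -- One generator `g` with `∣ g ∣ > k` at a time: `d` and `d ⊕ g` stay outside `T`, so `g` is the
    -- strict maximum of the triple `d`, `d ⊕ g`, `g`.
    homogeneous : ∀ {t} → T ∋ t → Homogeneous t
    homogeneous = span-ind (λ t → suc k ≤? ∣ t ∣) Homogeneous homogeneous-𝟎 homogeneous-⊕
      where
      homogeneous-𝟎 : Homogeneous 𝟎
      homogeneous-𝟎 = ∋-𝟎 T , λ c _ →
        subst (λ z → L c ⊆ L z) (sym (⊕-identityʳ c)) id , subst (λ z → L z ⊆ L c) (sym (⊕-identityʳ c)) id , λ {μ} _ → L-𝟎 μ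
      homogeneous-⊕ : ∀ {g t} → k < ∣ g ∣ → Homogeneous t → Homogeneous (g ⊕ t)
      homogeneous-⊕ {g} {t} k<g (t∈ , hom) = ∋-⊕ T (big k<g) t∈ , λ c c∉ →
        let d = c ⊕ t
            d∉ : ¬ T ∋ d
            d∉ = c∉ ∘ ∋-cancelʳ T t∈
            dg∉ : ¬ T ∋ d ⊕ g
            dg∉ = d∉ ∘ ∋-cancelʳ T (big k<g)
            c⊆d , d⊆c , c⊆t = hom c c∉
            d<g = ℕ.≤-<-trans (small d∉) k<g
            dg<g = ℕ.≤-<-trans (small dg∉) k<g
            d⊆dg = smaller-equal (xzy (tri d g)) d<g dg<g
            dg⊆d = smaller-equal (yxz (xzy (tri d g))) dg<g d<g
            eq : d ⊕ g ≡ c ⊕ (g ⊕ t)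
            eq = solve (c ∷ t ∷ g ∷ []) ((v₀ :⊕ v₁) :⊕ v₂) (v₀ :⊕ (v₂ :⊕ v₁)) refl
            c⊆ : L c ⊆ L (c ⊕ (g ⊕ t))
            c⊆ = subst (λ z → L c ⊆ L z) eq (d⊆dg ∘ c⊆d)
            ⊆c : L (c ⊕ (g ⊕ t)) ⊆ L c
            ⊆c = subst (λ z → L z ⊆ L c) eq (d⊆c ∘ dg⊆d)
            d⊆g = smaller-below (xzy (tri d g)) d<g dg<g
            c⊆g : L c ⊆ L g
            c⊆g = d⊆g ∘ c⊆d
            -- A functional `μ` of `L c` missing from `L (g ⊕ t)` would give `L (g ⊕ t) ⊆ L c` and
            -- `L g ⊆ L (g ⊕ t) + ⟨μ⟩`, hence `L g ⊆ L c` against the sizes.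
            c⊆gt : L c ⊆ L (g ⊕ t)
            c⊆gt = λ {μ} μ∈ → decidable-stable (L (g ⊕ t) ∋? μ) λ μ∉ →
              let gt⊆c = proj₁ (two-of-three (xzy (tri c (g ⊕ t))) μ∈ (c⊆ μ∈) μ∉)
                  cover = proj₂ (proj₂ (two-of-three (tri g t) (c⊆g μ∈) (c⊆t μ∈) μ∉))
              in ℕ.<⇒≱ k<g (ℕ.≤-trans (⊆⇒≤ (λ ν∈ → [ gt⊆c , ∋-cancelʳ (L c) μ∈ ∘ gt⊆c ]′ (cover ν∈))) (small c∉))
        in c⊆ , ⊆c , c⊆gt

    constant : ∀ {c t} → ¬ T ∋ c → T ∋ t → L c ⊆ L (c ⊕ t) × L (c ⊕ t) ⊆ L c
    constant {c} c∉ t∈ = let p , q , _ = proj₂ (homogeneous t∈) c c∉ in p , q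

    above : ∀ {c t} → ¬ T ∋ c → T ∋ t → L c ⊆ L t
    above {c} c∉ t∈ = proj₂ (proj₂ (proj₂ (homogeneous t∈) c c∉))

    constant′ : ∀ {c d} → ¬ T ∋ c → T ∋ c ⊕ d → L c ⊆ L d × L d ⊆ L c
    constant′ {c} {d} c∉ cd∈ = subst (λ z → L c ⊆ L z × L z ⊆ L c) (⊕-cancel c d) (constant c∉ cd∈)

    -- Outside `T` no size exceeds `k`, so members have size exactly `k`; this is what makes
    -- distinct spaces incomparable.
    S : V m → Set
    S c = ¬ T ∋ c × k ≤ ∣ c ∣

    S? : ∀ c → Dec (S c)
    S? c = ¬? (T ∋? c) ×-dec (k ≤? ∣ c ∣)

    S-nonempty : ∃ S
    S-nonempty = decidable-stable (any? S?) λ ∄c → h₀∉ (span-ind (λ t → k ≤? ∣ t ∣) (T ∋_) (∋-𝟎 T)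
      (λ {g} k≤g t∈ → ∋-⊕ T (decidable-stable (T ∋? g) (λ g∉ → ∄c (g , g∉ , k≤g))) t∈) (spans h₀))

    c₀ : V m
    c₀ = proj₁ S-nonempty

    c₀∉ : ¬ T ∋ c₀
    c₀∉ = proj₁ (proj₂ S-nonempty)

    k≤c₀ : k ≤ ∣ c₀ ∣
    k≤c₀ = proj₂ (proj₂ S-nonempty)

    S-incomparable : ∀ {a b} → S a → S b → L a ⊆ L b → L b ⊆ L a
    S-incomparable (_ , k≤a) (b∉ , _) a⊆b = ⊆∧≥⇒⊇ a⊆b (ℕ.≤-trans (small b∉) k≤a)

    -- All members of S carry the same space, which together with T gives a decomposer.
    module OneClass (one : ∀ {a b} → S a → S b → L a ⊆ L b) where

      below : ∀ {c} → ¬ T ∋ c → L c ⊆ L c₀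
      below {c} c∉ with T ∋? (c ⊕ c₀) | k ≤? ∣ c ∣ | k ≤? ∣ c ⊕ c₀ ∣
      ... | yes cc₀∈ | _      | _        = proj₁ (constant′ c∉ cc₀∈)
      ... | no _     | yes k≤ | _        = one (c∉ , k≤) (c₀∉ , k≤c₀)
      ... | no cc₀∉  | no c<k | no cc₀<k = smaller-below (subst (Tri c (c ⊕ c₀)) (⊕-cancel c c₀) (tri c (c ⊕ c₀)))
           (ℕ.<-≤-trans (ℕ.≰⇒> c<k) k≤c₀) (ℕ.<-≤-trans (ℕ.≰⇒> cc₀<k) k≤c₀)
      -- Here `c₀` and `c ⊕ c₀` have the same space, and `μ` is a functional that `L c` lacks.
      ... | no cc₀∉  | no c<k | yes k≤ with μ , μ∈ , μ∉ ← count-⊈ (L c₀ ∋?_) (L c ∋?_) (ℕ.<-≤-trans (ℕ.≰⇒> c<k) k≤c₀) =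
        proj₁ (two-of-three (yzx (tri c c₀)) μ∈ (one (c₀∉ , k≤c₀) (cc₀∉ , k≤) μ∈) μ∉)

      decomposing : ∀ {free} → ¬ L c₀ ∋ free → Decomposing L
      decomposing {free} free∉ = record
        { T = T ; missed = h₀ ; missed∉ = h₀∉ ; L₀ = L c₀ ; free = free ; free∉ = free∉
        ; above = above c₀∉ ; below = below ; constant = constant }

    -- The vectors with L = ⊤ span: every L is ⊤ or a hyperplane.
    module Spread (full₀ : ∀ μ → L c₀ ∋ μ) where

      -- Codimension at most one, without dimensions; the full space qualifies vacuously.
      Hyperplane : V m → Set
      Hyperplane c = ∀ {μ ν} → ¬ L c ∋ μ → ¬ L c ∋ ν → L c ∋ μ ⊕ ν

      Full : V m → Set
      Full c = ∀ μ → L c ∋ μ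

      full? : ∀ c → Dec (Full c)
      full? c = all? (L c ∋?_)

      big-full : ∀ {g} → k ≤ ∣ g ∣ → Full g
      big-full {g} k≤g μ = ⊆∧≥⇒⊇ {g} {c₀} (λ {ν} _ → full₀ ν) (ℕ.≤-trans (small c₀∉) k≤g) (full₀ μ)

      -- If `c` is full, `pivot` limits the loss to index two. Otherwise nothing of `L c` is lost,
      -- since `two-of-three` would put the full space `L g` inside `L c`.
      hyperplane-step : ∀ {g c} → Full g → Hyperplane c → Hyperplane (g ⊕ c)
      hyperplane-step {g} {c} g-full hyp {μ} {ν} μ∉ ν∉ with full? c
      ... | yes c-full = [ (λ p → contradiction p ν∉) , subst (L (g ⊕ c) ∋_) (⊕-comm ν μ) ]′
        (pivot (tri g c) (g-full μ) (μ∉ ∘ proj₂) (c-full ν))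
      ... | no ¬full = c⊆ (hyp (μ∉ ∘ c⊆) (ν∉ ∘ c⊆))
        where
        c⊆ : L c ⊆ L (g ⊕ c)
        c⊆ {ξ} ξ∈ = decidable-stable (L (g ⊕ c) ∋? ξ) λ ξ∉ →
          ¬full (λ ζ → proj₁ (proj₂ (two-of-three (tri g c) (g-full ξ) ξ∈ ξ∉)) (g-full ζ))

      hyperplane : ∀ c → Hyperplane c
      hyperplane c = span-ind (λ t → k ≤? ∣ t ∣) Hyperplane (λ {μ} {ν} _ _ → L-𝟎 (μ ⊕ ν))
        (λ k≤g hyp → hyperplane-step (big-full k≤g) hyp) (spans c)

      Y : V m → Set
      Y c = ¬ Full c

      Y? : ∀ c → Dec (Y c)
      Y? c = ¬? (full? c)

      Y-incomparable : ∀ {a b} → Y a → Y b → L a ⊆ L b → L b ⊆ L a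
      Y-incomparable {a} {b} _ ¬b-full a⊆b {μ} μ∈ with ζ , ζ∉ ← ¬∀⇒∃¬ (L b ∋?_) ¬b-full =
        decidable-stable (L a ∋? μ) λ μ∉ → ζ∉ (∋-cancelʳ (L b) μ∈ (a⊆b (hyperplane a (ζ∉ ∘ a⊆b) μ∉)))

      Y-sum : ∀ {a b} → Y a → Y b → ¬ L a ⊆ L b → Y (a ⊕ b)
      Y-sum {a} {b} ¬a-full _ a⊈b ab-full with μ , μ∈a , μ∉b ← ⊈⇒∃ (L a) (L b) a⊈b =
        ¬a-full (λ ζ → proj₁ (proj₂ (two-of-three (zxy (tri a b)) (ab-full μ) μ∈a μ∉b)) (ab-full ζ))

      -- Codimension at most one forces a nonzero vector in the plane of `e₁` and `e₂`. This is
      -- where the clique must have dimension at least two.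
      nonzero-in : ∀ c → ∃ λ dir → dir ≢ 𝟎 × L c ∋ dir
      nonzero-in c with L c ∋? e₁ | L c ∋? e₂
      ... | yes p | _     = e₁ , (λ ()) , p
      ... | no _  | yes q = e₂ , (λ ()) , q
      ... | no p  | no q  = e₁ ⊕ e₂ , (λ ()) , hyperplane c p q

      spread : Common L
      spread with any? (λ a → any? (λ b → Y? a ×-dec Y? b ×-dec ¬? (L a ⊆? L b)))
      -- With two different hyperplanes, `fixed` avoids `Y`, so every functional is constant over
      -- it; `e₁` is an arbitrary nonzero choice.
      ... | yes (a , b , Ya , Yb , a⊈b) = record
        { F = fixed ; T = fixed ; codim = fixed-codim ; T⊆F = id ; dir = e₁ ; dir≢𝟎 = λ ()
        ; shared = λ f∈ → decidable-stable (full? _) (fixed-avoids f∈) e₁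
        ; trivial = λ f∈ f∉ → contradiction f∈ f∉ }
        where open Stabiliser Y? Y-sum Y-incomparable Ya Yb a⊈b
      ... | no ∄ab with any? Y?
      ...   | no ∄Y = common {e₁} (λ ()) (λ h → decidable-stable (full? h) (λ Yh → ∄Y (h , Yh)) e₁)
      ...   | yes (a , Ya) with dir , dir≢𝟎 , dir∈ ← nonzero-in a = common dir≢𝟎 in-all
        where
        in-all : ∀ h → L h ∋ dir
        in-all h with full? h
        ... | yes h-full = h-full dir
        ... | no Yh      = decidable-stable (L a ⊆? L h) (λ a⊈h → ∄ab (a , h , Ya , Yh , a⊈h)) dir∈

    module TwoClasses {a b : V m} (Sa : S a) (Sb : S b) (a⊈b : ¬ L a ⊆ L b) where

      S-sum : ∀ {c d} → S c → S d → ¬ L c ⊆ L d → S (c ⊕ d)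
      S-sum {c} {d} (c∉ , k≤c) (d∉ , k≤d) c⊈d with μ , μ∈c , μ∉d ← ⊈⇒∃ (L c) (L d) c⊈d = cd∉ , k≤cd
        where
        cd∉ : ¬ T ∋ c ⊕ d
        cd∉ cd∈ = c⊈d (proj₁ (constant′ c∉ cd∈))
        k≤cd : k ≤ ∣ c ⊕ d ∣
        k≤cd with L (c ⊕ d) ∋? μ
        ... | yes μ∈cd = ℕ.≤-trans k≤c (⊆⇒≤ (proj₁ (proj₂ (two-of-three (xzy (tri c d)) μ∈c μ∈cd μ∉d))))
        ... | no μ∉cd  = ℕ.≤-trans k≤d (≤-by-coset μ∉d (pivot (tri c d) μ∈c (μ∉d ∘ proj₁)))

      open Stabiliser S? S-sum S-incomparable Sa Sb a⊈b

      -- A generator `g` inside `T` is the sum of `c₀` and `c₀ ⊕ g`, which both lie in `S` because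
      -- `L` is constant on `c₀ + T`.
      S-spans : ∀ h → span S? ∋ h
      S-spans h = span-ind (λ t → k ≤? ∣ t ∣) (span S? ∋_) (∋-𝟎 (span S?))
        (λ {g} k≤g → ∋-⊕ (span S?) (generator k≤g)) (spans h)
        where
        generator : ∀ {g} → k ≤ ∣ g ∣ → span S? ∋ g
        generator {g} k≤g with T ∋? g
        ... | no g∉  = span-gen S? (g∉ , k≤g)
        ... | yes g∈ = subst (span S? ∋_) (⊕-cancel c₀ g) (∋-⊕ (span S?) (span-gen S? (c₀∉ , k≤c₀))
          (span-gen S? (c₀∉ ∘ ∋-cancelʳ T g∈ , ℕ.≤-trans k≤c₀ (⊆⇒≤ (proj₁ (constant c₀∉ g∈))))))

      I : Sub (2 + s)
      I = L a ∩ˢ L b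

      μ₀ : V (2 + s)
      μ₀ = proj₁ (⊈⇒∃ (L a) (L b) a⊈b)

      μ₀∈a : L a ∋ μ₀
      μ₀∈a = proj₁ (proj₂ (⊈⇒∃ (L a) (L b) a⊈b))

      μ₀∉b : ¬ L b ∋ μ₀
      μ₀∉b = proj₂ (proj₂ (⊈⇒∃ (L a) (L b) a⊈b))

      module _ {f : V m} (f∈ : fixed ∋ f) (f∉T : ¬ T ∋ f) where

        f-small : ¬ k ≤ ∣ f ∣
        f-small k≤f = fixed-avoids f∈ (f∉T , k≤f)

        -- `f` fixes `c`, so `c` and `c ⊕ f` share a functional that the smaller space `L f` lacks.
        fixed-below : ∀ {c} → S c → L f ⊆ L c
        fixed-below {c} Sc with μ , μ∈c , μ∉f ← count-⊈ (L c ∋?_) (L f ∋?_) (ℕ.<-≤-trans (ℕ.≰⇒> f-small) (proj₂ Sc)) =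
          proj₁ (two-of-three (xzy (tri c f)) μ∈c (proj₂ (proj₂ (fixed-fixes f∈ (S-spans f) c Sc)) μ∈c) μ∉f)

        -- `L a` exceeds `L f` by the single direction `μ₀`, which `L b` does not contain. With
        -- `fixed-below`, `L f` is exactly `I`.
        fixed-above : I ⊆ L f
        fixed-above {ν} (ν∈a , ν∈b) = [ id , (λ q → contradiction (∋-cancelˡ (L b) ν∈b (fixed-below Sb q)) μ₀∉b) ]′
          (proj₂ (proj₂ (two-of-three (xzy (tri a f)) μ₀∈a (proj₂ (proj₂ (fixed-fixes f∈ (S-spans f) a Sa)) μ₀∈a) (μ₀∉b ∘ fixed-below Sb))) ν∈a)

      two-classes : Common L
      two-classes with any? (λ ν → ¬? (ν ≟ 𝟎) ×-dec (I ∋? ν))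
      ... | yes (ν , ν≢𝟎 , ν∈) = record
        { F = fixed ; T = fixed ; codim = fixed-codim ; T⊆F = id ; dir = ν ; dir≢𝟎 = ν≢𝟎
        ; shared = shared ; trivial = λ f∈ f∉ → contradiction f∈ f∉ }
        where
        shared : ∀ {f} → fixed ∋ f → L f ∋ ν
        shared {f} f∈ with T ∋? f
        ... | yes f∈T = above (proj₁ Sa) f∈T (proj₁ ν∈)
        ... | no f∉T  = fixed-above f∈ f∉T ν∈
      -- With `I` zero, so is `L f` for every `f` in `fixed` outside `T`, while `T` shares all of
      -- `L a`, in particular `μ₀`.
      ... | no I-trivial = record
        { F = fixed ; T = T ∩ˢ fixed ; codim = fixed-codim ; T⊆F = proj₂ ; dir = μ₀
        ; dir≢𝟎 = λ p → μ₀∉b (subst (L b ∋_) (sym p) (∋-𝟎 (L b)))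
        ; shared = λ (t∈ , _) → above (proj₁ Sa) t∈ μ₀∈a
        ; trivial = λ {f} f∈ f∉ {μ} μ∈ → decidable-stable (μ ≟ 𝟎) λ μ≢𝟎 →
            let f∉T = λ f∈T → f∉ (f∈T , f∈)
            in I-trivial (μ , μ≢𝟎 , fixed-below f∈ f∉T Sa μ∈ , fixed-below f∈ f∉T Sb μ∈) }

    outcome : Decomposing L ⊎ Common L
    outcome with any? (λ a → any? (λ b → S? a ×-dec S? b ×-dec ¬? (L a ⊆? L b)))
    ... | yes (a , b , Sa , Sb , a⊈b) = inj₂ (TwoClasses.two-classes Sa Sb a⊈b)
    ... | no ∄ab with all? (L c₀ ∋?_)
    ...   | yes full = inj₂ (Spread.spread full)
    ...   | no ¬full with free , free∉ ← ¬∀⇒∃¬ (L c₀ ∋?_) ¬full =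
      inj₁ (OneClass.decomposing (λ {a} {b} Sa Sb → decidable-stable (L a ⊆? L b) (λ a⊈b → ∄ab (a , b , Sa , Sb , a⊈b))) free∉)

  dichotomy : Decomposing L ⊎ Common L
  dichotomy with all? (atLeast (suc ∣ 𝟎 ∣) ∋?_)
  ... | no ¬full with k , ¬full′ , spans ← threshold ∣ 𝟎 ∣ ¬full
                 with h₀ , h₀∉ ← ¬∀⇒∃¬ (atLeast (suc k) ∋?_) ¬full′ = AtThreshold.outcome k h₀∉ spans
  ... | yes full = inj₂ (common {e₁} (λ ()) (λ h → subst (λ z → L z ∋ e₁) (sym (zero-only (full h))) (L-𝟎 e₁)))
    where
    zero-only : ∀ {h} → atLeast (suc ∣ 𝟎 ∣) ∋ h → h ≡ 𝟎
    zero-only = span-ind (λ t → suc ∣ 𝟎 ∣ ≤? ∣ t ∣) (_≡ 𝟎) refl (λ {t} 𝟎<t _ → contradiction (∣∣≤∣𝟎∣ t) (ℕ.<⇒≱ 𝟎<t))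

-- The family of spaces attached to a maximal clique.  In coordinates in which
-- the clique is V s × 𝟎, each fibre over y ≢ 𝟎 is a nonempty affine subspace of
-- V s, and L y consists of the functionals constant on it.

not≢ : ∀ b → b ≢ not b
not≢ false ()
not≢ true  ()

xor-not-not : ∀ a b → not a xor not b ≡ a xor b
xor-not-not true  b = refl
xor-not-not false b = Bool.not-involutive b

xor-cancelˡ : ∀ a {b c} → a xor b ≡ a xor c → b ≡ c
xor-cancelˡ false p = p
xor-cancelˡ true  p = Bool.not-injective p

xor-hit : ∀ a b c d → a ≢ b → a xor c ≡ d ⊎ b xor c ≡ d
xor-hit a b c d a≢b with (a xor c) Bool.≟ d
... | yes p = inj₁ p
... | no q  = inj₂ (trans (cong (_xor c) (¬-not (a≢b ∘ sym))) (trans (sym (Bool.not-distribˡ-xor a c))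
  (trans (cong not (¬-not q)) (Bool.not-involutive d))))

⇔⇒≡ : ∀ {a b} → (a ≡ true → b ≡ true) → (b ≡ true → a ≡ true) → b ≡ a
⇔⇒≡ {true}          f g = f refl
⇔⇒≡ {false} {true}  f g = sym (g refl)
⇔⇒≡ {false} {false} f g = refl

-- `nonempty` and `maximal` say that `V s × 𝟎` is a maximum clique: it cannot be extended by one
-- vector, nor can the kernel of `f` be extended by two vectors over `x` and `y`.
module Fibres
  (e : V s → V m → Bool)
  (noClaw : ∀ {w₁ y₁ w₂ y₂ w₃ y₃} → e w₁ y₁ ≡ true → e w₂ y₂ ≡ true → e w₃ y₃ ≡ true →
            e (w₁ ⊕ w₂) (y₁ ⊕ y₂) ≡ false → e (w₁ ⊕ w₃) (y₁ ⊕ y₃) ≡ false → e (w₂ ⊕ w₃) (y₂ ⊕ y₃) ≡ false →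
            e (w₁ ⊕ w₂ ⊕ w₃) (y₁ ⊕ y₂ ⊕ y₃) ≡ true)
  (e-𝟎 : ∀ w → e w 𝟎 ≡ false)
  (nonempty : ∀ {y} → y ≢ 𝟎 → ∃ λ w → e w y ≡ true)
  (maximal : ∀ {f w₀ x y} → f ≢ 𝟎 → x ≢ 𝟎 → y ≢ 𝟎 → x ≢ y → (∀ u → f ∙ u ≡ false → e (w₀ ⊕ u) x ≡ false) →
             ∀ u₀ → ∃ λ u → f ∙ u ≡ false × (e (u₀ ⊕ u) y ≡ true ⊎ e (w₀ ⊕ u₀ ⊕ u) (x ⊕ y) ≡ true))
  where

  record ConstantOn (y : V m) (f : V s) : Set where
    constructor constantOn
    field same : ∀ w w′ → e w y ≡ true → e w′ y ≡ true → f ∙ w ≡ f ∙ w′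
  open ConstantOn

  L : V m → Sub s
  L y = record
    { _∋_  = ConstantOn y
    ; _∋?_ = λ f → map′ constantOn same
        (all? λ w → all? λ w′ → (e w y Bool.≟ true) →-dec (e w′ y Bool.≟ true) →-dec (f ∙ w Bool.≟ f ∙ w′))
    ; ∋-𝟎  = constantOn λ w w′ _ _ → trans (∙-𝟎ˡ w) (sym (∙-𝟎ˡ w′))
    ; ∋-⊕  = λ {f} {g} f∈ g∈ → constantOn λ w w′ p q →
        trans (∙-⊕ˡ f g w) (trans (cong₂ _xor_ (same f∈ w w′ p q) (same g∈ w w′ p q)) (sym (∙-⊕ˡ f g w′)))
    }

  L-𝟎 : ∀ f → L 𝟎 ∋ f
  L-𝟎 f = constantOn λ w _ p → contradiction (e-𝟎 w) (true≢false p)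

  abstract
    a : V m → V s
    a y with any? (λ w → e w y Bool.≟ true)
    ... | yes (w , _) = w
    -- The empty fibre over `𝟎` gets the point `𝟎`, so that `additive` also holds when a summand is
    -- zero.
    ... | no _        = 𝟎

    a∈ : ∀ {y w} → e w y ≡ true → e (a y) y ≡ true
    a∈ {y} {w} p with any? (λ w → e w y Bool.≟ true)
    ... | yes (_ , q) = q
    ... | no ∄w       = contradiction (w , p) ∄w

    a-𝟎 : a 𝟎 ≡ 𝟎
    a-𝟎 with any? (λ w → e w 𝟎 Bool.≟ true)
    ... | yes (w , p) = contradiction (e-𝟎 w) (true≢false p)
    ... | no _        = refl

  a-in : ∀ {y} → y ≢ 𝟎 → e (a y) y ≡ true
  a-in y≢𝟎 = a∈ (proj₂ (nonempty y≢𝟎))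

  value : ∀ {y f w} → L y ∋ f → e w y ≡ true → f ∙ w ≡ f ∙ a y
  value f∈ p = same f∈ _ _ p (a∈ p)

  off : ∀ {y f w} → L y ∋ f → f ∙ w ≡ not (f ∙ a y) → e w y ≡ false
  off {y} {f} f∈ p = ¬-not (λ q → not≢ (f ∙ a y) (trans (sym (value f∈ q)) p))

  e-double : ∀ w y → e w (y ⊕ y) ≡ false
  e-double w y = subst (λ z → e w z ≡ false) (sym (⊕-self y)) (e-𝟎 w)

  -- Three points of one coset have pairwise sums in the clique, hence outside `E`, so claw-freeness
  -- puts their sum into `E`.
  affine : ∀ {y w₁ w₂ w₃} → e w₁ y ≡ true → e w₂ y ≡ true → e w₃ y ≡ true → e (w₁ ⊕ w₂ ⊕ w₃) y ≡ true
  affine {y} p q r = subst (λ z → e _ z ≡ true) (solve (y ∷ []) (v₀ :⊕ v₀ :⊕ v₀) v₀ refl)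
    (noClaw p q r (e-double _ y) (e-double _ y) (e-double _ y))

  ∉⇒∃ : ∀ {y f} → ¬ L y ∋ f → ∃₂ λ w w′ → e w y ≡ true × e w′ y ≡ true × f ∙ w ≢ f ∙ w′
  ∉⇒∃ {y} {f} f∉ = decidable-stable
    (any? λ w → any? λ w′ → (e w y Bool.≟ true) ×-dec (e w′ y Bool.≟ true) ×-dec ¬? (f ∙ w Bool.≟ f ∙ w′))
    λ ∄ → f∉ (constantOn λ w w′ p q → decidable-stable (f ∙ w Bool.≟ f ∙ w′) λ r → ∄ (w , w′ , p , q , r))

  tri-sum : ∀ {x y z : V m} → Tri x y z → y ⊕ z ≡ x
  tri-sum {x} {y} {z} p = sym (⊕≡𝟎⇒≡ x (y ⊕ z) (trans (sym (⊕-assoc x y z)) p))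

  -- As `f` varies on one of the fibres over `y` and `z`, there are `p` over `y` and `q` over `z`
  -- whose sum has the wrong `f`-value over `x`. Claw-freeness then shows that on the fibre over `z`
  -- the value of `μ` depends on that of `f` only.
  pivot : PivotRule L
  pivot {x} {y} {z} {f} {μ} xyz x∋f ¬both y∋μ with x ≟ 𝟎 | y ≟ 𝟎 | z ≟ 𝟎
  ... | yes refl | _ | _ = inj₁ (subst (λ h → L h ∋ μ) (⊕≡𝟎⇒≡ y z (tri-sum xyz)) y∋μ)
  ... | no _ | yes refl | _ = contradiction
    (L-𝟎 f , subst (λ h → L h ∋ f) (trans (sym (tri-sum xyz)) (⊕-identityˡ z)) x∋f) ¬both
  ... | no _ | no _ | yes refl = contradiction
    (subst (λ h → L h ∋ f) (trans (sym (tri-sum xyz)) (⊕-identityʳ y)) x∋f , L-𝟎 f) ¬both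
  ... | no x≢𝟎 | no y≢𝟎 | no z≢𝟎 with L z ∋? μ
  ...   | yes z∋μ = inj₁ z∋μ
  ...   | no z∌μ = inj₂ (constantOn λ w w′ w∈ w′∈ → trans (combined w w∈) (sym (combined w′ w′∈)))
    where
    Balanced : Set
    Balanced = ∃₂ λ p q → e p y ≡ true × e q z ≡ true × f ∙ p xor f ∙ q ≡ not (f ∙ a x)
    balanced : Balanced
    balanced with L y ∋? f
    ... | no y∌f with p , p′ , p∈ , p′∈ , p≢p′ ← ∉⇒∃ y∌f =
      [ (λ r → p , a z , p∈ , a-in z≢𝟎 , r) , (λ r → p′ , a z , p′∈ , a-in z≢𝟎 , r) ]′
      (xor-hit (f ∙ p) (f ∙ p′) (f ∙ a z) _ p≢p′)
    ... | yes y∋f with q , q′ , q∈ , q′∈ , q≢q′ ← ∉⇒∃ (λ z∋f → ¬both (y∋f , z∋f)) =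
      [ (λ r → a y , q , a-in y≢𝟎 , q∈ , trans (xor-comm (f ∙ a y) (f ∙ q)) r)
      , (λ r → a y , q′ , a-in y≢𝟎 , q′∈ , trans (xor-comm (f ∙ a y) (f ∙ q′)) r) ]′
      (xor-hit (f ∙ q) (f ∙ q′) (f ∙ a y) _ q≢q′)
    p q : V s
    p = proj₁ balanced
    q = proj₁ (proj₂ balanced)
    p∈ : e p y ≡ true
    p∈ = proj₁ (proj₂ (proj₂ balanced))
    q∈ : e q z ≡ true
    q∈ = proj₁ (proj₂ (proj₂ (proj₂ balanced)))
    pq : f ∙ p xor f ∙ q ≡ not (f ∙ a x)
    pq = proj₂ (proj₂ (proj₂ (proj₂ balanced)))
    constant : ∀ w w′ → e w z ≡ true → e w′ z ≡ true → f ∙ w ≡ f ∙ w′ → μ ∙ w ≡ μ ∙ w′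
    constant w w′ w∈ w′∈ ww′ = xor-cancelˡ (μ ∙ p) (trans (trans (sym (∙-⊕ʳ μ p w)) shifted-value) (∙-⊕ʳ μ p w′))
      where
      -- `q₂` has the same `f`-value as `q`, so `p`, `q`, `q₂` have no pairwise sum in `E`, and
      -- their sum is `p ⊕ w ⊕ w′`.
      q₂ : V s
      q₂ = q ⊕ w ⊕ w′
      fq₂ : f ∙ q₂ ≡ f ∙ q
      fq₂ = trans (∙-⊕ʳ f (q ⊕ w) w′) (trans (cong₂ _xor_ (∙-⊕ʳ f q w) (sym ww′))
        (trans (xor-assoc (f ∙ q) _ _) (trans (cong (f ∙ q xor_) (xor-same (f ∙ w))) (xor-identityʳ _))))
      off-x : ∀ {r} → f ∙ r ≡ f ∙ q → e (p ⊕ r) (y ⊕ z) ≡ false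
      off-x {r} fr = subst (λ h → e (p ⊕ r) h ≡ false) (sym (tri-sum xyz))
        (off x∋f (trans (∙-⊕ʳ f p r) (trans (cong (f ∙ p xor_) fr) pq)))
      shifted : e (p ⊕ w ⊕ w′) y ≡ true
      shifted = subst₂ (λ r h → e r h ≡ true)
        (solve (p ∷ q ∷ w ∷ w′ ∷ []) (v₀ :⊕ v₁ :⊕ (v₁ :⊕ v₂ :⊕ v₃)) (v₀ :⊕ v₂ :⊕ v₃) refl)
        (⊕-cancelʳ y z)
        (noClaw p∈ q∈ (affine q∈ w∈ w′∈) (off-x refl) (off-x fq₂) (e-double _ z))
      shifted-value : μ ∙ (p ⊕ w) ≡ μ ∙ (p ⊕ w′)
      shifted-value = xor-cancelˡ (μ ∙ w′) (trans (xor-comm (μ ∙ w′) _) (trans (trans (sym (∙-⊕ʳ μ (p ⊕ w) w′)) (same y∋μ _ _ shifted p∈))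
        (trans (cong (μ ∙_) (solve (p ∷ w′ ∷ []) v₀ (v₁ :⊕ (v₀ :⊕ v₁)) refl)) (∙-⊕ʳ μ w′ (p ⊕ w′)))))
    w₁ w₂ : V s
    w₁ = proj₁ (∉⇒∃ z∌μ)
    w₂ = proj₁ (proj₂ (∉⇒∃ z∌μ))
    w₁∈ : e w₁ z ≡ true
    w₁∈ = proj₁ (proj₂ (proj₂ (∉⇒∃ z∌μ)))
    w₂∈ : e w₂ z ≡ true
    w₂∈ = proj₁ (proj₂ (proj₂ (proj₂ (∉⇒∃ z∌μ))))
    μw₁≢μw₂ : μ ∙ w₁ ≢ μ ∙ w₂
    μw₁≢μw₂ = proj₂ (proj₂ (proj₂ (proj₂ (∉⇒∃ z∌μ))))
    -- A nonconstant `μ` that depends on `f` alone flips exactly when `f` does.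
    combined : ∀ w → e w z ≡ true → (μ ⊕ f) ∙ w ≡ μ ∙ w₁ xor f ∙ w₁
    combined w w∈ with f ∙ w Bool.≟ f ∙ w₁
    ... | yes r = trans (∙-⊕ˡ μ f w) (cong₂ _xor_ (constant w w₁ w∈ w₁∈ r) r)
    ... | no r  = trans (∙-⊕ˡ μ f w) (trans
      (cong₂ _xor_ (trans (constant w w₂ w∈ w₂∈ (trans (¬-not r) (sym (¬-not fw₂≢)))) (¬-not (μw₁≢μw₂ ∘ sym))) (¬-not r))
      (xor-not-not (μ ∙ w₁) (f ∙ w₁)))
      where
      fw₂≢ : f ∙ w₂ ≢ f ∙ w₁
      fw₂≢ q = μw₁≢μw₂ (constant w₁ w₂ w₁∈ w₂∈ (sym q))

  -- `w₀` and `u₀` have the wrong `f`-values over `x` and `y`, so their translates of the kernel of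
  -- `f` avoid `E`. By `maximal` the translate by `w₀ ⊕ u₀` over `x ⊕ y` meets `E`, and two wrong
  -- values add up like two right ones.
  additive : ∀ {x y f} → L x ∋ f → L y ∋ f → L (x ⊕ y) ∋ f → f ∙ a (x ⊕ y) ≡ f ∙ a x xor f ∙ a y
  additive {x} {y} {f} x∋f y∋f xy∋f with f ≟ 𝟎 | x ≟ 𝟎 | y ≟ 𝟎 | x ≟ y
  ... | yes refl | _ | _ | _ = trans (∙-𝟎ˡ (a (x ⊕ y))) (sym (cong₂ _xor_ (∙-𝟎ˡ (a x)) (∙-𝟎ˡ (a y))))
  ... | no _ | yes refl | _ | _ = trans (cong (λ h → f ∙ a h) (⊕-identityˡ y))
    (sym (cong (_xor f ∙ a y) (trans (cong (f ∙_) a-𝟎) (∙-𝟎ʳ f))))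
  ... | no _ | no _ | yes refl | _ = trans (cong (λ h → f ∙ a h) (⊕-identityʳ x))
    (sym (trans (cong (f ∙ a x xor_) (trans (cong (f ∙_) a-𝟎) (∙-𝟎ʳ f))) (xor-identityʳ _)))
  ... | no _ | no _ | no _ | yes refl = trans (trans (cong (λ h → f ∙ a h) (⊕-self x)) (trans (cong (f ∙_) a-𝟎) (∙-𝟎ʳ f)))
    (sym (xor-same (f ∙ a x)))
  ... | no f≢𝟎 | no x≢𝟎 | no y≢𝟎 | no x≢y = conclude
    (maximal f≢𝟎 x≢𝟎 y≢𝟎 x≢y (λ u fu → off x∋f (trans (∙-⊕ʳ f w₀ u) (trans (cong (f ∙ w₀ xor_) fu) (trans (xor-identityʳ _) fw₀)))) u₀)
    where
    w₀ u₀ : V s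
    w₀ = proj₁ (≢𝟎⇒∃∙≡ f f≢𝟎 (not (f ∙ a x)))
    u₀ = proj₁ (≢𝟎⇒∃∙≡ f f≢𝟎 (not (f ∙ a y)))
    fw₀ : f ∙ w₀ ≡ not (f ∙ a x)
    fw₀ = proj₂ (≢𝟎⇒∃∙≡ f f≢𝟎 (not (f ∙ a x)))
    fu₀ : f ∙ u₀ ≡ not (f ∙ a y)
    fu₀ = proj₂ (≢𝟎⇒∃∙≡ f f≢𝟎 (not (f ∙ a y)))
    plus-u : ∀ v {u} → f ∙ u ≡ false → f ∙ (v ⊕ u) ≡ f ∙ v
    plus-u v {u} fu = trans (∙-⊕ʳ f v u) (trans (cong (f ∙ v xor_) fu) (xor-identityʳ _))
    conclude : (∃ λ u → f ∙ u ≡ false × (e (u₀ ⊕ u) y ≡ true ⊎ e (w₀ ⊕ u₀ ⊕ u) (x ⊕ y) ≡ true)) →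
               f ∙ a (x ⊕ y) ≡ f ∙ a x xor f ∙ a y
    conclude (u , fu , inj₁ p) = contradiction p (λ p → true≢false p (off y∋f (trans (plus-u u₀ fu) fu₀)))
    conclude (u , fu , inj₂ p) = trans (sym (value xy∋f p)) (trans (plus-u (w₀ ⊕ u₀) fu)
      (trans (∙-⊕ʳ f w₀ u₀) (trans (cong₂ _xor_ fw₀ fu₀) (xor-not-not (f ∙ a x) (f ∙ a y)))))

  -- An affine subspace is cut out by the functionals constant on it; `separate` is applied to its
  -- direction space `D`.
  characterise : ∀ {y w} → y ≢ 𝟎 → (∀ {f} → L y ∋ f → f ∙ w ≡ f ∙ a y) → e w y ≡ true
  characterise {y} {w} y≢𝟎 h = decidable-stable (e w y Bool.≟ true) λ w∉ →
    let f , kills , fw = separate D (a y ⊕ w) (w∉ ∘ subst (λ r → e r y ≡ true) (⊕-cancel (a y) w))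
        f∈ : ∀ u → e u y ≡ true → f ∙ u ≡ f ∙ a y
        f∈ u u∈ = sym (xor-cancelˡ (f ∙ a y) (trans (xor-same (f ∙ a y)) (sym (trans (sym (∙-⊕ʳ f (a y) u))
          (kills (subst (λ r → e r y ≡ true) (sym (⊕-cancel (a y) u)) u∈))))))
        fa≡ : f ∙ w ≡ f ∙ a y
        fa≡ = h {f} (constantOn λ u u′ u∈ u′∈ → trans (f∈ u u∈) (sym (f∈ u′ u′∈)))
    in true≢false fw (trans (∙-⊕ʳ f (a y) w) (trans (cong (f ∙ a y xor_) fa≡) (xor-same (f ∙ a y))))
    where
    D : Sub s
    D = record
      { _∋_  = λ d → e (a y ⊕ d) y ≡ true
      ; _∋?_ = λ d → e (a y ⊕ d) y Bool.≟ true
      ; ∋-𝟎  = subst (λ r → e r y ≡ true) (sym (⊕-identityʳ (a y))) (a-in y≢𝟎)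
      ; ∋-⊕  = λ {d} {d′} d∈ d′∈ → subst (λ r → e r y ≡ true)
          (solve (a y ∷ d ∷ d′ ∷ []) (v₀ :⊕ (v₀ :⊕ v₁) :⊕ (v₀ :⊕ v₂)) (v₀ :⊕ (v₁ :⊕ v₂)) refl) (affine (a-in y≢𝟎) d∈ d′∈)
      }

  -- Taking `P` to be `L₀` gives the decomposer, and taking `P` to be the single functional `dir`
  -- gives the hyperplane containing `E`. Closure under sums is `additive`.
  module Graph (T : Sub m) (P : V s → Set) (P? : ∀ f → Dec (P f)) (P⊆ : ∀ {t f} → T ∋ t → P f → L t ∋ f) where

    D : V s → V m → Set
    D w t = T ∋ t × (∀ f → P f → f ∙ w ≡ f ∙ a t)

    D? : ∀ w t → Dec (D w t)
    D? w t = (T ∋? t) ×-dec all? (λ f → P? f →-dec (f ∙ w Bool.≟ f ∙ a t))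

    D-𝟎 : D 𝟎 𝟎
    D-𝟎 = ∋-𝟎 T , λ f _ → cong (f ∙_) (sym a-𝟎)

    D-⊕ : ∀ {w t w′ t′} → D w t → D w′ t′ → D (w ⊕ w′) (t ⊕ t′)
    D-⊕ {w} {t} {w′} {t′} (t∈ , p) (t′∈ , q) = ∋-⊕ T t∈ t′∈ , λ f Pf → trans (∙-⊕ʳ f w w′)
      (trans (cong₂ _xor_ (p f Pf) (q f Pf)) (sym (additive (P⊆ t∈ Pf) (P⊆ t′∈ Pf) (P⊆ (∋-⊕ T t∈ t′∈) Pf))))

    D-cancel : ∀ {w t w′ t′} → D w′ t′ → D (w ⊕ w′) (t ⊕ t′) → D w t
    D-cancel d d′ = subst₂ D (⊕-cancelʳ _ _) (⊕-cancelʳ _ _) (D-⊕ d′ d)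

    e⇒D : ∀ {w t} → T ∋ t → e w t ≡ true → D w t
    e⇒D t∈ p = t∈ , λ f Pf → value (P⊆ t∈ Pf) p

  module Split (decomposing : Decomposing L) where
    open Decomposing decomposing
    open Graph T (L₀ ∋_) (L₀ ∋?_) (λ t∈ → above t∈) public

    private
      forward : ∀ {w y w′ t} → ¬ T ∋ y → D w′ t → e w y ≡ true → e (w ⊕ w′) (y ⊕ t) ≡ true
      forward {w} {y} {w′} {t} y∉ (t∈ , w′∈) p = characterise yt≢𝟎 λ {f} f∈ →
        let f∈y = proj₂ (constant y∉ t∈) f∈
            f∈L₀ = below y∉ f∈y
        in trans (∙-⊕ʳ f w w′) (trans (cong₂ _xor_ (value f∈y p) (w′∈ f f∈L₀)) (sym (additive f∈y (above t∈ f∈L₀) f∈)))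
        where
        yt≢𝟎 : y ⊕ t ≢ 𝟎
        yt≢𝟎 q = y∉ (subst (T ∋_) (sym (⊕≡𝟎⇒≡ y t q)) t∈)

    -- Over `T` all of `E` lies in `D`, so both sides are false. Elsewhere `L (y ⊕ t) = L y ⊆ L₀`,
    -- and translation by a member of `D` shifts every prescribed value correctly.
    invariant : ∀ {w y w′ t} → ¬ D w y → D w′ t → e (w ⊕ w′) (y ⊕ t) ≡ e w y
    invariant {w} {y} {w′} {t} ∉D d with T ∋? y
    ... | yes y∈ = trans (¬-not (λ p → ∉D (D-cancel d (e⇒D (∋-⊕ T y∈ (proj₁ d)) p)))) (sym (¬-not (λ p → ∉D (e⇒D y∈ p))))
    ... | no y∉  = ⇔⇒≡ (forward y∉ d) (λ p → subst₂ (λ r h → e r h ≡ true) (⊕-cancelʳ w w′) (⊕-cancelʳ y t)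
                     (forward (y∉ ∘ ∋-cancelʳ T (proj₁ d)) d p))

    missed∉D : ∀ w → ¬ D w missed
    missed∉D w (t∈ , _) = missed∉ t∈

    kernel-vector : ∃ λ w → w ≢ 𝟎 × D w 𝟎
    kernel-vector with w , kills , w∙free ← separate L₀ free free∉ =
      w , (λ { refl → true≢false w∙free (∙-𝟎ˡ free) }) , ∋-𝟎 T ,
      λ f f∈ → trans (∙-comm f w) (trans (kills f∈) (sym (trans (cong (f ∙_) a-𝟎) (∙-𝟎ʳ f))))

  module Flatten (common : Common L) where
    open Common common public

    private
      shared-≡ : ∀ {t f} → T ∋ t → f ≡ dir → L t ∋ f
      shared-≡ t∈ refl = shared t∈

    open Graph T (_≡ dir) (_≟ dir) shared-≡ public

    top-full : ∀ {y} w → F ∋ y → ¬ T ∋ y → e w y ≡ true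
    top-full {y} w y∈ y∉ = characterise (λ { refl → y∉ (∋-𝟎 T) }) λ f∈ → in-trivial (trivial y∈ y∉ f∈)
      where
      in-trivial : ∀ {f} → f ≡ 𝟎 → f ∙ w ≡ f ∙ a y
      in-trivial refl = trans (∙-𝟎ˡ w) (sym (∙-𝟎ˡ (a y)))

    shift : V s
    shift = proj₁ (≢𝟎⇒∃∙ dir dir≢𝟎)

    private
      dir∙shift : ∀ w → dir ∙ (w ⊕ shift) ≡ not (dir ∙ w)
      dir∙shift w = trans (∙-⊕ʳ dir w shift) (trans (cong (dir ∙ w xor_) (proj₂ (≢𝟎⇒∃∙ dir dir≢𝟎))) (xor-comm _ true))

    shift-leaves : ∀ {w t} → D w t → ¬ D (w ⊕ shift) t
    shift-leaves {w} {t} (_ , p) (_ , q) = not≢ (dir ∙ w) (trans (p dir refl) (trans (sym (q dir refl)) (dir∙shift w)))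

    shift-enters : ∀ {w t} → T ∋ t → ¬ D w t → D (w ⊕ shift) t
    shift-enters {w} {t} t∈ ∉D = t∈ , λ { f refl → trans (dir∙shift w)
      (sym (¬-not (λ q → ∉D (t∈ , λ { _ refl → sym q })))) }

-- The induction

-- size (size s) = 2^(2^s) bounds the number of spaces L c ≤ V s.
abstract
  bound : ℕ → ℕ
  bound zero    = 0
  bound (suc s) = size (size (suc s)) + (1 + (bound s + bound s))

  -- The cost of `flatten`: one recursive call, one hyperplane and the stabiliser. `bound-double` is
  -- the cost of the two recursive calls in `combine`.
  bound-step : ∀ s → bound s + (1 + size (size (suc s))) ≤ bound (suc s)
  bound-step s = ℕ.≤-trans (ℕ.≤-reflexive (rearrange (bound s) (size (size (suc s)))))
    (ℕ.+-monoʳ-≤ (size (size (suc s))) (s≤s (ℕ.m≤m+n (bound s) (bound s))))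
    where
    open +-*-Solver renaming (solve to ℕ-solve)
    rearrange : ∀ b c → b + (1 + c) ≡ c + (1 + b)
    rearrange = ℕ-solve 2 (λ b c → b :+ (con 1 :+ c) := c :+ (con 1 :+ b)) refl

  bound-double : ∀ s → bound s + bound s ≤ bound (suc s)
  bound-double s = ℕ.≤-trans (ℕ.n≤1+n _) (ℕ.m≤n+m _ (size (size (suc s))))

bound-mono : s ≤ t → bound s ≤ bound t
bound-mono s≤t = go (ℕ.≤⇒≤′ s≤t)
  where
  go : ∀ {s t} → s ≤′ t → bound s ≤ bound t
  go ≤′-refl = ℕ.≤-refl
  go (≤′-step {n = t} le) = ℕ.≤-trans (go le) (ℕ.≤-trans (ℕ.m≤m+n _ _) (bound-double t))

last-before : {P : ℕ → Set} → (∀ k → Dec (P k)) → ∀ d a → P a → ¬ P (d + a) →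
              ∃ λ b → a ≤ b × b < d + a × P b × ¬ P (suc b)
last-before P? zero    a p ¬p = contradiction p ¬p
last-before {P} P? (suc d) a p ¬p with P? (suc a)
... | no ¬q = a , ℕ.≤-refl , s≤s (ℕ.m≤n+m a d) , p , ¬q
... | yes q with b , a<b , b< , r ← last-before P? d (suc a) q (¬p ∘ subst P (ℕ.+-suc d a)) =
  b , ℕ.<⇒≤ a<b , subst (b <_) (ℕ.+-suc d a) b< , r

module Reduction (E : V n → Bool) (E-𝟎 : E 𝟎 ≡ false) (noClaw : NoClaw E) where

  record Reduced (s : ℕ) (S : Sub n) : Set₁ where
    field
      F      : Sub n
      inside : F ⊆ S
      codim  : Codim≤ (bound s) F S
      tower  : Tower E s F
  open Reduced

  -- A triangle in the complement is a two-dimensional clique, so `S` is a single level above zero.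
  reduced-one : (S : Sub n) → ¬ HasClique E S 2 → Reduced 1 S
  reduced-one S ¬clique = record
    { F = S ; inside = id ; codim = codim-mono S {S} z≤n (codim-⊆ {A = S} {S} id)
    ; tower = step {A = ⊥ˢ} (λ { refl → ∋-𝟎 S }) (base id) (record
      { invariant = λ { _ _ refl → cong E (⊕-identityʳ _) } ; triangleFree = tri-free }) }
    where
    tri-free : ∀ {x y} → S ∋ x → S ∋ y → x ≢ 𝟎 → y ≢ 𝟎 → x ⊕ y ≢ 𝟎 → E x ≡ false → E y ≡ false → E (x ⊕ y) ≢ false
    tri-free {x} {y} x∈ y∈ x≢ y≢ xy≢ Ex Ey Exy = ¬clique (x ∷ y ∷ [] , λ
      { (false ∷ false ∷ []) p → contradiction refl p
      ; (true ∷ false ∷ []) _ → good (solve (x ∷ y ∷ []) v₀ (v₀ :⊕ (:𝟎 :⊕ :𝟎)) refl) x∈ x≢ Ex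
      ; (false ∷ true ∷ []) _ → good (solve (x ∷ y ∷ []) v₁ (:𝟎 :⊕ (v₁ :⊕ :𝟎)) refl) y∈ y≢ Ey
      ; (true ∷ true ∷ []) _ → good (solve (x ∷ y ∷ []) (v₀ :⊕ v₁) (v₀ :⊕ (v₁ :⊕ :𝟎)) refl) (∋-⊕ S x∈ y∈) xy≢ Exy })
      where
      good : ∀ {v w} → v ≡ w → S ∋ v → v ≢ 𝟎 → E v ≡ false → S ∋ w × w ≢ 𝟎 × E w ≡ false
      good refl a b c = a , b , c

  -- Splitting along a nontrivial decomposer

  module Decompose {s : ℕ} (S A : Sub n) (A⊆S : A ⊆ S)
    (decomposer : ∀ {v a} → S ∋ v → ¬ A ∋ v → A ∋ a → E (v ⊕ a) ≡ E v)
    (¬clique : ¬ HasClique E S (3 + s))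
    (clique₁ : HasClique E A 1)
    (rec-small : ∀ r → r ≤ s → ∀ S → ¬ HasClique E S (2 + r) → Reduced (1 + r) S)
    (rec-A : ¬ HasClique E A (3 + s) → Reduced (2 + s) A)
    where

    open Complement (directComplement A S A⊆S) renaming (space to C; inside to C⊆S)

    absorb : ∀ {a c} → A ∋ a → C ∋ c → c ≢ 𝟎 → E (a ⊕ c) ≡ E c
    absorb {a} {c} a∈ c∈ c≢𝟎 = trans (cong E (⊕-comm a c))
      (decomposer (C⊆S c∈) (λ c∈A → c≢𝟎 (disjoint c∈A c∈)) a∈)

    join-cliques : ∀ {j l} → HasClique E A j → HasClique E C l → HasClique E S (j + l)
    join-cliques {j} {l} (g , g-clique) (h , h-clique) = g ++ h , λ u u≢𝟎 →
      subst (λ v → S ∋ v × v ≢ 𝟎 × E v ≡ false) (sym (comb-++ g h u)) (joined (fstV j u) (sndV j u) (u≢𝟎 ∘ uncurried u))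
      where
      uncurried : ∀ u → fstV j u ≡ 𝟎 × sndV j u ≡ 𝟎 → u ≡ 𝟎
      uncurried u (p , q) = fstV-sndV-𝟎 j u p q
      joined : ∀ x y → ¬ (x ≡ 𝟎 × y ≡ 𝟎) → S ∋ comb g x ⊕ comb h y × comb g x ⊕ comb h y ≢ 𝟎 × E (comb g x ⊕ comb h y) ≡ false
      joined x y ≢𝟎 with y ≟ 𝟎
      ... | yes refl = subst (λ v → S ∋ v × v ≢ 𝟎 × E v ≡ false) (sym (trans (cong (comb g x ⊕_) (comb-𝟎 h)) (⊕-identityʳ _)))
        (let p , q , r = g-clique x (λ x≡𝟎 → ≢𝟎 (x≡𝟎 , refl)) in A⊆S p , q , r)
      ... | no y≢𝟎 = let c∈ , c≢𝟎 , Ec = h-clique y y≢𝟎 in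
        ∋-⊕ S (A⊆S a∈) (C⊆S c∈) , (λ p → c≢𝟎 (disjoint (subst (A ∋_) (⊕≡𝟎⇒≡ _ _ p) a∈) c∈)) , trans (absorb a∈ c∈ c≢𝟎) Ec
        where
        a∈ : A ∋ comb g x
        a∈ = clique-⊆S E {S = A} {g = g} g-clique x

    drop : Reduced (2 + s) A → ¬ HasClique E C 1 → Reduced (2 + s) S
    drop R ¬clique-C = record
      { F      = F R ⊞ C
      ; inside = ⊞-⊆ (F R) C S (A⊆S ∘ inside R) C⊆S
      ; codim  = codim-mono (F R ⊞ C) {S} (ℕ.≤-reflexive (trans (ℕ.+-identityʳ _) (ℕ.+-identityʳ _)))
          (codim-trans (F R ⊞ C) {A ⊞ C} {S}
            (codim-⊞ (F R) C {A} {C} (codim R) (codim-⊆ {A = C} {C} id)) (codim-⊆ {A = A ⊞ C} {S} covers))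
      ; tower  = tower-top E (F R ⊞ C) (⊞-inˡ (F R) C) full (tower R)
      }
      where
      E-C : ∀ {c} → C ∋ c → c ≢ 𝟎 → E c ≡ true
      E-C {c} c∈ c≢𝟎 = ¬-not (λ Ec → ¬clique-C (singleClique E {C} {c} c∈ c≢𝟎 Ec))
      full : ∀ {v} → F R ⊞ C ∋ v → ¬ F R ∋ v → E v ≡ true
      full (f , c , f∈ , c∈ , refl) v∉ = trans (absorb (inside R f∈) c∈ c≢𝟎) (E-C c∈ c≢𝟎)
        where
        c≢𝟎 : c ≢ 𝟎
        c≢𝟎 refl = v∉ (subst (F R ∋_) (sym (⊕-identityʳ f)) f∈)

    combine : ∀ {r o} → r + o ≡ s → Reduced (1 + r) A → Reduced (1 + o) C → Reduced (2 + s) S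
    combine {r} {o} refl RA RC = record
      { F      = F RA ⊞ F RC
      ; inside = ⊞-⊆ (F RA) (F RC) S (A⊆S ∘ inside RA) (C⊆S ∘ inside RC)
      ; codim  = codim-mono (F RA ⊞ F RC) {S} bounds
          (codim-trans (F RA ⊞ F RC) {A ⊞ C} {S}
            (codim-⊞ (F RA) (F RC) {A} {C} (codim RA) (codim RC)) (codim-⊆ {A = A ⊞ C} {S} covers))
      ; tower  = subst (λ j → Tower E j (F RA ⊞ F RC)) levels
          (tower-append E (λ a∈ c∈ → absorb (inside RA a∈) (inside RC c∈)) (tower RA) (tower RC))
      }
      where
      levels : (1 + o) + (1 + r) ≡ 2 + (r + o)
      levels = cong suc (trans (ℕ.+-suc o r) (cong suc (ℕ.+-comm o r)))
      bounds : bound (1 + r) + bound (1 + o) + 0 ≤ bound (2 + (r + o))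
      bounds = ℕ.≤-trans (ℕ.≤-reflexive (ℕ.+-identityʳ _)) (ℕ.≤-trans
        (ℕ.+-mono-≤ (bound-mono (s≤s (ℕ.m≤m+n r o))) (bound-mono (s≤s (ℕ.m≤n+m o r)))) (bound-double (1 + (r + o))))

    decompose : Reduced (2 + s) S
    decompose = by-clique-number (last-before (hasClique? E A) (2 + s) 1 clique₁
      (¬clique-A ∘ subst (HasClique E A) (ℕ.+-comm (2 + s) 1)))
      where
      ¬clique-A : ¬ HasClique E A (3 + s)
      ¬clique-A = ¬clique ∘ clique-⊆ E {A = A} {S} A⊆S
      by-clique-number : (∃ λ r → 1 ≤ r × r < 2 + s + 1 × HasClique E A r × ¬ HasClique E A (suc r)) → Reduced (2 + s) S
      by-clique-number (suc r , _ , s≤s r< , clique-r , ¬clique-r) with r ≤? s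
      -- Clique numbers add under `join-cliques`: `A` has `1 + r`, so `C` has at most `1 + o`, and
      -- the level counts sum to `2 + s`.
      ... | yes r≤s with o , refl ← ℕ.m≤n⇒∃[o]m+o≡n r≤s =
        combine refl (rec-small r r≤s A ¬clique-r) (rec-small o (ℕ.m≤n+m o r) C (λ c → ¬clique
          (subst (HasClique E S) (cong suc (trans (ℕ.+-suc r (1 + o)) (cong suc (ℕ.+-suc r o)))) (join-cliques clique-r c))))
      -- `A` attains the full clique number `2 + s`, so `C` has no clique at all and is contained in
      -- `E` apart from `𝟎`.
      ... | no r≰s = drop (rec-A ¬clique-A) (λ c → ¬clique
        (subst (HasClique E S) (trans (ℕ.+-comm (suc r) 1) (cong (2 +_) r≡)) (join-cliques clique-r c)))
        where
        r≡ : r ≡ 1 + s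
        r≡ = ℕ.≤-antisym (ℕ.≤-pred (subst (suc r ≤_) (ℕ.+-comm (1 + s) 1) r<)) (ℕ.≰⇒> r≰s)

  -- Coordinates along a maximum clique

  module Coordinates {s : ℕ} (S : Sub n) {g : Vec (V n) (2 + s)} (g-clique : IsClique E S g)
    (¬clique : ¬ HasClique E S (3 + s))
    (rec-small : ∀ r → r ≤ s → ∀ S → ¬ HasClique E S (2 + r) → Reduced (1 + r) S)
    (rec-smaller : ∀ A → count (A ∋?_) < count (S ∋?_) → ¬ HasClique E A (3 + s) → Reduced (2 + s) A)
    where

    open Extension (extend S g (clique-indep E {S = S} {g = g} g-clique) (clique-⊆S E {S = S} {g = g} g-clique))
      renaming (dim to corank; vectors to h; inside to h⊆S)

    g⊆S : ∀ w → S ∋ comb g w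
    g⊆S = clique-⊆S E {S = S} {g = g} g-clique

    pt : V (2 + s) → V corank → V n
    pt w y = comb g w ⊕ comb h y

    pt∈ : ∀ w y → S ∋ pt w y
    pt∈ w y = ∋-⊕ S (g⊆S w) (h⊆S y)

    pt-⊕ : ∀ w y w′ y′ → pt (w ⊕ w′) (y ⊕ y′) ≡ pt w y ⊕ pt w′ y′
    pt-⊕ w y w′ y′ = trans (cong₂ _⊕_ (comb-⊕ g w w′) (comb-⊕ h y y′)) (⊕-interchange (comb g w) _ _ _)

    pt-𝟎ʳ : ∀ w → pt w 𝟎 ≡ comb g w
    pt-𝟎ʳ w = trans (cong (comb g w ⊕_) (comb-𝟎 h)) (⊕-identityʳ _)

    pt-𝟎 : pt 𝟎 𝟎 ≡ 𝟎
    pt-𝟎 = trans (pt-𝟎ʳ 𝟎) (comb-𝟎 g)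

    pt-inj : ∀ {w y w′ y′} → pt w y ≡ pt w′ y′ → w ≡ w′ × y ≡ y′
    pt-inj {w} {y} {w′} {y′} p =
      let q , r = indep (w ⊕ w′) (y ⊕ y′) (trans (pt-⊕ w y w′ y′) (trans (cong (_⊕ pt w′ y′) p) (⊕-self _)))
      in ⊕≡𝟎⇒≡ w w′ q , ⊕≡𝟎⇒≡ y y′ r

    pt-y≢𝟎 : ∀ {w y} → y ≢ 𝟎 → pt w y ≢ 𝟎
    pt-y≢𝟎 y≢𝟎 p = y≢𝟎 (proj₂ (pt-inj (trans p (sym pt-𝟎))))

    e : V (2 + s) → V corank → Bool
    e w y = E (pt w y)

    e-𝟎 : ∀ w → e w 𝟎 ≡ false
    e-𝟎 w = trans (cong E (pt-𝟎ʳ w)) (clique-∉ E {S = S} {g = g} E-𝟎 g-clique w)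

    e-noClaw : ∀ {w₁ y₁ w₂ y₂ w₃ y₃} → e w₁ y₁ ≡ true → e w₂ y₂ ≡ true → e w₃ y₃ ≡ true →
      e (w₁ ⊕ w₂) (y₁ ⊕ y₂) ≡ false → e (w₁ ⊕ w₃) (y₁ ⊕ y₃) ≡ false → e (w₂ ⊕ w₃) (y₂ ⊕ y₃) ≡ false →
      e (w₁ ⊕ w₂ ⊕ w₃) (y₁ ⊕ y₂ ⊕ y₃) ≡ true
    e-noClaw p q r pq pr qr = trans (cong E (trans (pt-⊕ _ _ _ _) (cong (_⊕ pt _ _) (pt-⊕ _ _ _ _))))
      (noClaw _ _ _ p q r (trans (cong E (sym (pt-⊕ _ _ _ _))) pq) (trans (cong E (sym (pt-⊕ _ _ _ _))) pr)
        (trans (cong E (sym (pt-⊕ _ _ _ _))) qr))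

    Good : V n → Set
    Good v = S ∋ v × v ≢ 𝟎 × E v ≡ false

    good : ∀ {w y v} → pt w y ≡ v → y ≢ 𝟎 → e w y ≡ false → Good v
    good {w} {y} refl y≢𝟎 p = pt∈ w y , pt-y≢𝟎 y≢𝟎 , p

    nonempty : ∀ {y} → y ≢ 𝟎 → ∃ λ w → e w y ≡ true
    nonempty {y} y≢𝟎 = decidable-stable (any? (λ w → e w y Bool.≟ true)) λ ∄w → ¬clique (comb h y ∷ g , λ
      { (true ∷ u)  _    → good {u} {y} (⊕-comm (comb g u) (comb h y)) y≢𝟎 (¬-not (λ p → ∄w (u , p)))
      ; (false ∷ u) u≢𝟎 → subst Good (sym (⊕-identityˡ _)) (g-clique u (λ { refl → u≢𝟎 refl })) })

    -- Otherwise the kernel of `f`, of dimension `1 + s`, and the points over `x` and `y` span a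
    -- clique of dimension `3 + s`.
    maximal : ∀ {f w₀ x y} → f ≢ 𝟎 → x ≢ 𝟎 → y ≢ 𝟎 → x ≢ y → (∀ u → f ∙ u ≡ false → e (w₀ ⊕ u) x ≡ false) →
              ∀ u₀ → ∃ λ u → f ∙ u ≡ false × (e (u₀ ⊕ u) y ≡ true ⊎ e (w₀ ⊕ u₀ ⊕ u) (x ⊕ y) ≡ true)
    maximal {f} {w₀} {x} {y} f≢𝟎 x≢𝟎 y≢𝟎 x≢y x-out u₀ = decidable-stable
      (any? (λ u → (f ∙ u Bool.≟ false) ×-dec ((e (u₀ ⊕ u) y Bool.≟ true) ⊎-dec (e (w₀ ⊕ u₀ ⊕ u) (x ⊕ y) Bool.≟ true))))
      λ ∄u → ¬clique (pt w₀ x ∷ pt u₀ y ∷ columns (comb g ∘ hyp f) , clique-vectors ∄u)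
      where
      kernel : V (1 + s) → V n
      kernel u = comb g (hyp f u)
      kernel-columns : ∀ u → comb (columns (comb g ∘ hyp f)) u ≡ kernel u
      kernel-columns u = comb-columns (comb g ∘ hyp f)
        (λ a b → trans (cong (comb g) (hyp-lin f a b)) (comb-⊕ g (hyp f a) (hyp f b))) u
      add-kernel : ∀ w y u → pt (w ⊕ hyp f u) y ≡ pt w y ⊕ kernel u
      add-kernel w y u = trans (cong (pt (w ⊕ hyp f u)) (sym (⊕-identityʳ y)))
        (trans (pt-⊕ w y (hyp f u) 𝟎) (cong (pt w y ⊕_) (pt-𝟎ʳ (hyp f u))))
      clique-vectors : ¬ (∃ λ u → f ∙ u ≡ false × (e (u₀ ⊕ u) y ≡ true ⊎ e (w₀ ⊕ u₀ ⊕ u) (x ⊕ y) ≡ true)) →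
        IsClique E S (pt w₀ x ∷ pt u₀ y ∷ columns (comb g ∘ hyp f))
      clique-vectors ∄u (a ∷ b ∷ u) u≢𝟎 = subst (λ k → Good (a · pt w₀ x ⊕ (b · pt u₀ y ⊕ k))) (sym (kernel-columns u)) (cases a b u≢𝟎)
        where
        P Q K : V n
        P = pt w₀ x
        Q = pt u₀ y
        K = kernel u
        cases : ∀ a b → a ∷ b ∷ u ≢ 𝟎 → Good (a · P ⊕ (b · Q ⊕ K))
        cases false false u≢𝟎 = subst Good (solve (K ∷ []) v₀ (:𝟎 :⊕ (:𝟎 :⊕ v₀)) refl)
          (g-clique (hyp f u) (λ q → u≢𝟎 (cong (λ z → false ∷ false ∷ z) (hyp-inj f f≢𝟎 u q))))
        cases true false _ = good {w₀ ⊕ hyp f u} {x}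
          (trans (add-kernel w₀ x u) (solve (P ∷ K ∷ []) (v₀ :⊕ v₁) (v₀ :⊕ (:𝟎 :⊕ v₁)) refl)) x≢𝟎 (x-out (hyp f u) (hyp-∙ f u))
        cases false true _ = good {u₀ ⊕ hyp f u} {y}
          (trans (add-kernel u₀ y u) (solve (Q ∷ K ∷ []) (v₀ :⊕ v₁) (:𝟎 :⊕ (v₀ :⊕ v₁)) refl)) y≢𝟎
          (¬-not (λ p → ∄u (hyp f u , hyp-∙ f u , inj₁ p)))
        cases true true _ = good {w₀ ⊕ u₀ ⊕ hyp f u} {x ⊕ y}
          (trans (add-kernel (w₀ ⊕ u₀) (x ⊕ y) u) (trans (cong (_⊕ K) (pt-⊕ w₀ x u₀ y)) (⊕-assoc P Q K)))
          (λ q → x≢y (⊕≡𝟎⇒≡ x y q)) (¬-not (λ p → ∄u (hyp f u , hyp-∙ f u , inj₂ p)))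

    module Fib = Fibres e e-noClaw e-𝟎 nonempty maximal

    module Coord (D : V (2 + s) → V corank → Set) (D? : ∀ w y → Dec (D w y)) (D-𝟎 : D 𝟎 𝟎)
      (D-⊕ : ∀ {w t w′ t′} → D w t → D w′ t′ → D (w ⊕ w′) (t ⊕ t′)) where

      sub : Sub n
      sub = record
        { _∋_  = λ v → ∃₂ λ w y → D w y × pt w y ≡ v
        ; _∋?_ = λ v → any? (λ w → any? (λ y → D? w y ×-dec (pt w y ≟ v)))
        ; ∋-𝟎  = 𝟎 , 𝟎 , D-𝟎 , pt-𝟎
        ; ∋-⊕  = λ { (w , y , d , refl) (w′ , y′ , d′ , refl) → w ⊕ w′ , y ⊕ y′ , D-⊕ d d′ , pt-⊕ w y w′ y′ }
        }

      sub-in : ∀ {w y} → D w y → sub ∋ pt w y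
      sub-in {w} {y} d = w , y , d , refl

      sub-out : ∀ {w y} → sub ∋ pt w y → D w y
      sub-out {w} {y} (w′ , y′ , d , p) with refl , refl ← pt-inj {w′} {y′} {w} {y} p = d

      sub⊆S : sub ⊆ S
      sub⊆S (w , y , _ , refl) = pt∈ w y

    module Decomposition (decomposing : Decomposing Fib.L) where
      open Fib.Split decomposing
      open Coord D D? D-𝟎 D-⊕
      open Decomposing decomposing using (missed)

      decomposer : ∀ {v a} → S ∋ v → ¬ sub ∋ v → sub ∋ a → E (v ⊕ a) ≡ E v
      decomposer {v} {a} v∈ v∉ a∈ = in-coordinates (spans v∈) a∈
        where
        in-coordinates : (∃₂ λ w y → pt w y ≡ v) → sub ∋ a → E (v ⊕ a) ≡ E v
        in-coordinates (w , y , refl) (w′ , t , d , refl) =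
          trans (cong E (sym (pt-⊕ w y w′ t))) (invariant (v∉ ∘ sub-in) d)

      smaller : count (sub ∋?_) < count (S ∋?_)
      smaller = count-strict (sub ∋?_) (S ∋?_) (λ _ → sub⊆S) (pt 𝟎 missed) (missed∉D 𝟎 ∘ sub-out) (pt∈ 𝟎 missed)

      clique₁ : HasClique E sub 1
      clique₁ = let w , w≢𝟎 , d = kernel-vector in
        singleClique E {sub} {pt w 𝟎} (sub-in d) (λ p → w≢𝟎 (proj₁ (pt-inj {w} {𝟎} (trans p (sym pt-𝟎))))) (e-𝟎 w)

      result : Reduced (2 + s) S
      result = Decompose.decompose S sub sub⊆S decomposer ¬clique clique₁ rec-small (rec-smaller sub smaller)

    module Flattening (common : Common Fib.L) where
      open Fib.Flatten common renaming (F to Y; codim to Y-codim)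

      over : Sub corank → Sub n
      over B = Coord.sub (λ _ y → B ∋ y) (λ _ → B ∋?_) (∋-𝟎 B) (∋-⊕ B)

      open Complement (directComplement T Y T⊆F) renaming (space to C; inside to C⊆Y)

      open Coord D D? D-𝟎 D-⊕ renaming (sub to A; sub-in to A-in; sub-out to A-out; sub⊆S to A⊆S)

      fibre-lin : Linear (pt 𝟎)
      fibre-lin y y′ = trans (cong (λ z → pt z (y ⊕ y′)) (sym (⊕-self 𝟎))) (pt-⊕ 𝟎 y 𝟎 y′)

      Ĉ : Sub n
      Ĉ = Coord.sub (λ w y → w ≡ 𝟎 × C ∋ y) (λ w y → (w ≟ 𝟎) ×-dec (C ∋? y)) (refl , ∋-𝟎 C)
        (λ { (refl , a) (refl , b) → ⊕-self 𝟎 , ∋-⊕ C a b })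

      -- Over `T` the set `E` lies in `A`, and translation by the clique vector `pt shift 𝟎` leaves
      -- `A`; so that vector extends every clique of `A`.
      ¬clique-A : ¬ HasClique E A (2 + s)
      ¬clique-A (k , k-clique) = ¬clique (pt shift 𝟎 ∷ k , λ
        { (true ∷ u)  _   → shifted (clique-⊆S E {S = A} {g = k} k-clique u)
        ; (false ∷ u) u≢𝟎 → subst Good (sym (⊕-identityˡ _))
            (let a , b , c = k-clique u (λ { refl → u≢𝟎 refl }) in A⊆S a , b , c) })
        where
        shifted : ∀ {v} → A ∋ v → Good (pt shift 𝟎 ⊕ v)
        shifted (w , t , d , refl) = subst Good eq (pt∈ _ _ ,
          (λ p → shift-leaves d (A-out (subst (A ∋_) (sym p) (∋-𝟎 A)))) ,
          ¬-not (λ p → shift-leaves d (e⇒D (proj₁ d) p)))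
          where
          eq : pt (w ⊕ shift) t ≡ pt shift 𝟎 ⊕ pt w t
          eq = trans (cong₂ pt (⊕-comm w shift) (sym (⊕-identityˡ t))) (pt-⊕ shift 𝟎 w t)

      codim₁ : Codim≤ (size (size (2 + s))) (over Y) S
      codim₁ = map (pt 𝟎) (proj₁ Y-codim) , λ v∈ → cover (spans v∈)
        where
        cover : ∀ {v} → (∃₂ λ w y → pt w y ≡ v) → ∃ λ u → over Y ∋ v ⊕ comb (map (pt 𝟎) (proj₁ Y-codim)) u
        cover (w , y , refl) with u , y∈ ← proj₂ Y-codim {y} refl = u , w , _ , y∈ ,
          trans (cong (λ z → pt z (y ⊕ comb (proj₁ Y-codim) u)) (sym (⊕-identityʳ w)))
            (trans (pt-⊕ w y 𝟎 _) (cong (pt w y ⊕_) (sym (comb-map (pt 𝟎) fibre-lin pt-𝟎 (proj₁ Y-codim) u))))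

      -- `dir` has two values, so over `T` either `w` or `w ⊕ shift` meets the hyperplane condition.
      codim₂ : Codim≤ 1 (A ⊞ Ĉ) (over Y)
      codim₂ = pt shift 𝟎 ∷ [] , cover
        where
        A⊞Ĉ : ∀ {w t c v} → D w t → C ∋ c → pt w (t ⊕ c) ≡ v → A ⊞ Ĉ ∋ v
        A⊞Ĉ {w} {t} {c} d c∈ refl = pt w t , pt 𝟎 c , A-in d , (𝟎 , c , (refl , c∈) , refl) ,
          trans (sym (pt-⊕ w t 𝟎 c)) (cong (λ z → pt z (t ⊕ c)) (⊕-identityʳ w))
        cover : ∀ {v} → over Y ∋ v → ∃ λ u → A ⊞ Ĉ ∋ v ⊕ comb (pt shift 𝟎 ∷ []) u
        cover (w , y , y∈ , refl) = in-coordinates (covers y∈)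
          where
          Covered : Set
          Covered = ∃ λ u → A ⊞ Ĉ ∋ pt w y ⊕ comb (pt shift 𝟎 ∷ []) u
          in-coordinates : (∃₂ λ t c → T ∋ t × C ∋ c × t ⊕ c ≡ y) → Covered
          in-coordinates (t , c , t∈ , c∈ , refl) = by-cases (D? w t)
            where
            by-cases : Dec (D w t) → Covered
            by-cases (yes d) = false ∷ [] , A⊞Ĉ d c∈ (solve (pt w y ∷ []) v₀ (v₀ :⊕ (:𝟎 :⊕ :𝟎)) refl)
            by-cases (no ∉D) = true ∷ [] , A⊞Ĉ (shift-enters t∈ ∉D) c∈
              (trans (cong (pt (w ⊕ shift)) (sym (⊕-identityʳ y))) (trans (pt-⊕ w y shift 𝟎)
                (cong (pt w y ⊕_) (sym (⊕-identityʳ (pt shift 𝟎))))))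

      -- Vectors with nonzero `C`-part lie over `Y` outside `T`, hence in `E`, and join the top
      -- level; the level saved in `A` is filled by padding.
      flatten : Reduced (1 + s) A → Reduced (2 + s) S
      flatten R = record
        { F      = G
        ; inside = ⊞-⊆ (F R) Ĉ S (A⊆S ∘ inside R) (λ { (w , y , _ , refl) → pt∈ w y })
        ; codim  = codim-mono G {S} bounds (codim-trans G {over Y} {S}
            (codim-trans G {A ⊞ Ĉ} {over Y} (codim-⊞ (F R) Ĉ {A} {Ĉ} (codim R) (codim-⊆ {A = Ĉ} {Ĉ} id)) codim₂) codim₁)
        ; tower  = tower-top E G (⊞-inˡ (F R) Ĉ) full (tower-pad E 1 (tower R))
        }
        where
        G : Sub n
        G = F R ⊞ Ĉ
        bounds : bound (1 + s) + 0 + 1 + size (size (2 + s)) ≤ bound (2 + s)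
        bounds = ℕ.≤-trans (ℕ.≤-reflexive (trans (cong (λ b → b + 1 + size (size (2 + s))) (ℕ.+-identityʳ (bound (1 + s))))
          (ℕ.+-assoc (bound (1 + s)) 1 (size (size (2 + s)))))) (bound-step (1 + s))
        full : ∀ {v} → G ∋ v → ¬ F R ∋ v → E v ≡ true
        full (f , _ , f∈ , (_ , c , (refl , c∈) , refl) , refl) v∉ = from-A (inside R f∈)
          where
          from-A : A ∋ f → E (f ⊕ pt 𝟎 c) ≡ true
          from-A (w , t , d , refl) = trans (cong E (trans (sym (pt-⊕ w t 𝟎 c)) (cong (λ z → pt z (t ⊕ c)) (⊕-identityʳ w))))
            (top-full w (∋-⊕ Y (T⊆F (proj₁ d)) (C⊆Y c∈)) λ tc∈ → v∉
              (subst (F R ∋_) (sym (trans (cong (λ z → pt w t ⊕ pt 𝟎 z) (disjoint (∋-cancelˡ T (proj₁ d) tc∈) c∈))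
                (trans (cong (pt w t ⊕_) pt-𝟎) (⊕-identityʳ _)))) f∈))

      result : Reduced (2 + s) S
      result = flatten (rec-small s ℕ.≤-refl A ¬clique-A)

    reduced : Reduced (2 + s) S
    reduced = [ Decomposition.result , Flattening.result ]′ (Dichotomy.dichotomy Fib.L Fib.pivot Fib.L-𝟎)

  -- The inner induction on the number of elements of `S` is for a proper decomposer that keeps the
  -- whole clique number; all other calls lower `s`.
  reduce : ∀ s (S : Sub n) → ¬ HasClique E S (2 + s) → Reduced (1 + s) S
  reduce = <-rec _ λ { zero _ → reduced-one ; (suc s) rec S → reduce-step s (λ r r≤s → rec (s≤s r≤s)) (count (S ∋?_)) S refl }
    where
    reduce-step : ∀ s → (∀ r → r ≤ s → ∀ S → ¬ HasClique E S (2 + r) → Reduced (1 + r) S) →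
      ∀ k (S : Sub n) → count (S ∋?_) ≡ k → ¬ HasClique E S (3 + s) → Reduced (2 + s) S
    reduce-step s rec-small = <-rec _ λ { k rec S refl ¬clique → by-clique rec S refl ¬clique (hasClique? E S (2 + s)) }
      where
      by-clique : ∀ {k} → (∀ {j} → j < k → (S : Sub n) → count (S ∋?_) ≡ j → ¬ HasClique E S (3 + s) → Reduced (2 + s) S) →
        (S : Sub n) → count (S ∋?_) ≡ k → ¬ HasClique E S (3 + s) → Dec (HasClique E S (2 + s)) → Reduced (2 + s) S
      by-clique rec S refl ¬clique (yes (g , g-clique)) =
        Coordinates.reduced S {g} g-clique ¬clique rec-small (λ A A<S → rec A<S A refl)
      by-clique rec S _ ¬clique (no ¬clique′) = record
        { F = F R ; inside = inside R ; tower = tower-pad E 1 (tower R)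
        ; codim = codim-mono (F R) {S} (bound-mono (ℕ.n≤1+n (1 + s))) (codim R) }
        where
        R : Reduced (1 + s) S
        R = rec-small s ℕ.≤-refl S ¬clique′

theorem1p7 : ∀ (s : ℕ) → 1 ≤ s →
    Σ ℕ λ k → 2 ≤ k ×
    (∀ (n : ℕ) (M : Matroid n) → ClawFree M → α≤ M s →
    Σ (Vec AnyMatroid (suc (2 * s))) λ Ms →
    (∀ i → TriangleFree (complement (proj₂ (lookup Ms i)))) ×
    Σ (Flat (proj₁ (iterLiftJoin Ms)) n) λ ψ →
    (n ∸ proj₁ (iterLiftJoin Ms) ≤ k) ×
    Iso (restrict M ψ) (proj₂ (iterLiftJoin Ms)))
theorem1p7 (suc s) _ = 2 + bound (suc s) , ℕ.m≤m+n 2 _ , λ n M clawFree α →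
  let open Reduction.Reduced (Reduction.reduce (E M) (E-𝟎 M) (clawFree⇒noClaw M clawFree) s ⊤ˢ (α≤⇒¬clique M α))
  in towerToLiftJoin M
       -- The `suc s` levels are padded to `2 * suc s`; the factor of dimension `0` at the bottom
       -- completes the odd count.
       (subst (λ t → Tower (E M) t F) (ℕ.+-comm (suc s + 0) (suc s)) (tower-pad (E M) (suc s + 0) tower))
       -- The summand `2` in the constant secures `2 ≤ k`.
       (codim-mono F {⊤ˢ} (ℕ.m≤n+m (bound (suc s)) 2) codim)
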